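{- Let $n>2$ be an integer, let $r$ be a Golay number, and let $k_1,k_2,\dots,k_{2^{n-3}-1}$ be complex Golay numbers (for $n=3$ this list is empty). Put $m=2\sum_{j=1}^{2^{n-3}-1}k_j+r+1$ and $q=2^{n-1}+n-1$. Then there exists a complex orthogonal design $$COD\Big(2^q m;\ 2^q,\ 2^q r,\ 2^{q+1}k_1,\ \dots,\ 2^{q+1}k_{2^{n-3}-1}\Big).$$
   Context: For a sequence $A=(a_1,\dots,a_n)$ of complex numbers, its non-periodic autocorrelation function is $N_A(j)=\sum_{i=1}^{n-j}a_{i+j}\overline{a_i}$ for $0\le j\le n-1$ and $N_A(j)=0$ for $j\ge n$. A Golay pair of length $n$ is a pair $(A;B)$ of sequences of length $n$ with entries in $\{\pm1\}$ such that $N_A(j)+N_B(j)=0$ for all $j>0$; a Golay number is a positive integer $n$ for which a Golay pair of length $n$ exists. A complex Golay pair of length $n$ is a pair of sequences of length $n$ with entries in $\{\pm1,\pm i\}$ with the same property, and a complex Golay number is a positive integer for which a complex Golay pair of that length exists. A complex orthogonal design $COD(N;\,c_1,\dots,c_k)$ is an $N\times N$ matrix $X$ with entries from $\{0,\pm x_1,\pm ix_1,\dots,\pm x_k,\pm ix_k\}$ ($x_j$ commuting real variables) satisfying $XX^*=\big(\sum_{j=1}^k c_jx_j^2\big)I_N$ with positive integers $c_j$, where $*$ denotes conjugate transpose. -}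

module Defs where

open import Data.Nat as ℕ using (ℕ; zero; suc; _<_; _^_; _∸_)
open import Data.Integer as ℤ using (ℤ; +_; -_; 0ℤ; 1ℤ)
open import Data.Fin using (Fin; zero; suc; _≟_)
open import Data.Vec using (Vec; lookup)
open import Data.Product using (Σ; _×_; ∃; _,_)
open import Data.Bool using (Bool; true; false; if_then_else_; _∧_)
open import Relation.Nullary using (does)
open import Relation.Binary.PropositionalEquality using (_≡_)

-- Gaussian integers Z[i] (all quantities in the statement lie here)

record ℤ[i] : Set where
  constructor _+i_
  field
    re : ℤ
    im : ℤ
open ℤ[i] public

0ᵍ : ℤ[i]
0ᵍ = 0ℤ +i 0ℤ

fromℕᵍ : ℕ → ℤ[i]
fromℕᵍ n = (+ n) +i 0ℤ

_+ᵍ_ : ℤ[i] → ℤ[i] → ℤ[i]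
(a +i b) +ᵍ (c +i d) = (a ℤ.+ c) +i (b ℤ.+ d)

_*ᵍ_ : ℤ[i] → ℤ[i] → ℤ[i]
(a +i b) *ᵍ (c +i d) = (a ℤ.* c ℤ.- b ℤ.* d) +i (a ℤ.* d ℤ.+ b ℤ.* c)

conj : ℤ[i] → ℤ[i]
conj (a +i b) = a +i (- b)

∑ : (n : ℕ) → (Fin n → ℤ[i]) → ℤ[i]
∑ zero    f = 0ᵍ
∑ (suc n) f = f zero +ᵍ ∑ n (λ i → f (suc i))

data Sign : Set where
  plus minus : Sign

data Unit4 : Set where
  one i mone mi : Unit4

signVal : Sign → ℤ[i]
signVal plus  = 1ℤ +i 0ℤ
signVal minus = (- 1ℤ) +i 0ℤ

unitVal : Unit4 → ℤ[i]
unitVal one  = 1ℤ +i 0ℤ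
unitVal i    = 0ℤ +i 1ℤ
unitVal mone = (- 1ℤ) +i 0ℤ
unitVal mi   = 0ℤ +i (- 1ℤ)

-- Non-periodic autocorrelation.
-- A sequence of length n is extended by zeros: ext a k = a_k for k < n, 0 else.
-- Then N_A(j) = Σ_{i<n} a_{i+j} conj(a_i), which equals the paper's
-- Σ_{i=1}^{n-j} a_{i+j} conj(a_i) (and is 0 for j ≥ n).

ext : {A : Set} {n : ℕ} → (A → ℤ[i]) → Vec A n → ℕ → ℤ[i]
ext {n = n} val a k with k ℕ.<? n
... | Relation.Nullary.yes k<n = val (lookup a (Data.Fin.fromℕ< k<n))
... | Relation.Nullary.no  _   = 0ᵍ

autocorr : {A : Set} {n : ℕ} → (A → ℤ[i]) → Vec A n → ℕ → ℤ[i]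
autocorr {n = n} val a j =
  ∑ n (λ k → ext val a (Data.Fin.toℕ k ℕ.+ j) *ᵍ conj (ext val a (Data.Fin.toℕ k)))

IsGolayPair : {n : ℕ} → Vec Sign n → Vec Sign n → Set
IsGolayPair a b = ∀ j → 0 < j → autocorr signVal a j +ᵍ autocorr signVal b j ≡ 0ᵍ

IsComplexGolayPair : {n : ℕ} → Vec Unit4 n → Vec Unit4 n → Set
IsComplexGolayPair a b = ∀ j → 0 < j → autocorr unitVal a j +ᵍ autocorr unitVal b j ≡ 0ᵍ

GolayNumber : ℕ → Set
GolayNumber n = 0 < n × Σ (Vec Sign n) λ a → Σ (Vec Sign n) λ b → IsGolayPair a b

ComplexGolayNumber : ℕ → Set
ComplexGolayNumber n = 0 < n × Σ (Vec Unit4 n) λ a → Σ (Vec Unit4 n) λ b → IsComplexGolayPair a b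

-- Complex orthogonal designs in v commuting real variables x_0..x_{v-1}.
-- An entry is 0 or u·x_s with u ∈ {±1, ±i}.

data Entry (v : ℕ) : Set where
  zer : Entry v
  var : Unit4 → Fin v → Entry v

eqᶠ : {v : ℕ} → Fin v → Fin v → Bool
eqᶠ s t = does (s ≟ t)

-- contribution of X_{al} conj(X_{bl}) to the ordered monomial x_s x_t
contrib : {v : ℕ} → Entry v → Entry v → Fin v → Fin v → ℤ[i]
contrib (var u s') (var w t') s t =
  if eqᶠ s' s ∧ eqᶠ t' t then unitVal u *ᵍ conj (unitVal w) else 0ᵍ
contrib _ _ _ _ = 0ᵍ

ordCoeff : {N v : ℕ} → (Fin N → Fin N → Entry v) → Fin N → Fin N → Fin v → Fin v → ℤ[i]
ordCoeff {N} X a b s t = ∑ N (λ l → contrib (X a l) (X b l) s t)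

-- coefficient of the monomial x_s x_t (as a polynomial in commuting variables)
coeff : {N v : ℕ} → (Fin N → Fin N → Entry v) → Fin N → Fin N → Fin v → Fin v → ℤ[i]
coeff X a b s t =
  if eqᶠ s t then ordCoeff X a b s s else ordCoeff X a b s t +ᵍ ordCoeff X a b t s

-- X X* = (Σ_j c_j x_j^2) I_N, as an identity of polynomials
IsCOD : {N v : ℕ} → (Fin v → ℕ) → (Fin N → Fin N → Entry v) → Set
IsCOD {N} {v} c X = ∀ (a b : Fin N) (s t : Fin v) →
  coeff X a b s t ≡ (if eqᶠ a b ∧ eqᶠ s t then fromℕᵍ (c s) else 0ᵍ)

COD : (N : ℕ) {v : ℕ} → (Fin v → ℕ) → Set
COD N {v} c = (∀ j → 0 < c j) × Σ (Fin N → Fin N → Entry v) (IsCOD c)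

sumℕ : (L : ℕ) → (Fin L → ℕ) → ℕ
sumℕ zero    k = 0
sumℕ (suc L) k = k zero ℕ.+ sumℕ L (λ j → k (suc j))

codWeights : (q r L : ℕ) → (Fin L → ℕ) → Fin (2 ℕ.+ L) → ℕ
codWeights q r L k zero          = 2 ^ q
codWeights q r L k (suc zero)    = 2 ^ q ℕ.* r
codWeights q r L k (suc (suc j)) = 2 ^ (q ℕ.+ 1) ℕ.* k j

{-# OPTIONS --safe #-}

-- Let T be the cyclic shift of order m.  Elements e₁, …, eₛ of the commutative ring ℤ[i][T]/(Tᵐ − 1), with
-- the involution e* = ē(T⁻¹), give 2ˢ × 2ˢ matrices U₁, …, Uₛ with UₗUₗ* = eₗeₗ* and UₗUₗ′* + Uₗ′Uₗ* = 0 for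
-- l ≠ l′: on bit vectors ρ, Uₗ flips bit l and multiplies by (−1)^(ρ₁ + … + ρₗ₋₁) and by eₗ, or by eₗ* if an
-- odd number of the other bits is set.  Every variable contributes a pair (e, f) with ee* + ff* constant:
-- (1, 1) for x, the Golay pair for y, and C ± D* for the j-th complex Golay pair (C, D).  Placing the blocks
-- symmetrically around 0 in ℤ/m, where y occupies the middle, gives disjoint supports that are invariant
-- under *.  An extra bit κ separates e from f, and multiplying on the right by I₂ ⊗ (Sylvester matrix) fills
-- in the zeros, since each row then combines elements with disjoint supports.
module Submission where

open import Defs
open import Data.Nat using (ℕ; _<_; _+_; _*_; _^_; _∸_)
open import Data.Fin using (Fin)

open import Algebra.Bundles using (CommutativeRing)
import Algebra.Properties.CommutativeSemigroup as CommutativeSemigroupₚ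
open import Data.Bool using (Bool; true; false; not; _∧_; _xor_; if_then_else_)
import Data.Bool.Properties as Boolₚ
open import Data.Empty using (⊥-elim)
open import Data.Fin using (zero; suc; toℕ; fromℕ<; inject≤; punchIn; combine; remQuot; _↑ˡ_; _↑ʳ_; _≟_)
import Data.Fin.Properties as Finₚ
open import Data.Integer as ℤ using (ℤ; +_; -[1+_]; 0ℤ; 1ℤ; _%ℕ_; _/ℕ_)
import Data.Integer.DivMod as ℤ%
import Data.Integer.Properties as ℤₚ
open import Data.Integer.Tactic.RingSolver using (solve-∀)
open import Data.Nat using (zero; suc; _≤_; s≤s; z≤n; z<s; NonZero; >-nonZero; _<?_; _%_; _⊓_)
import Data.Nat.DivMod as ℕ%
import Data.Nat.Properties as ℕₚ
import Data.Nat.Tactic.RingSolver as ℕSolver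
open import Data.Product using (_×_; _,_; proj₁; proj₂; ∃)
open import Data.Sum using (_⊎_; inj₁; inj₂)
open import Data.Vec using (Vec; []; _∷_; lookup; updateAt)
import Data.Vec.Properties as Vecₚ
open import Function using (_∘_)
open import Relation.Binary using (tri<; tri≈; tri>)
open import Relation.Binary.PropositionalEquality
open import Relation.Nullary using (yes; no; does)
open import Relation.Nullary.Decidable using (dec-true; dec-false)

-- Arithmetic of Gaussian integers

-- With `K` the sum of the `k j`, the weights add up to `2^q (1 + r + 2K) = 2^q m`, the order of the
-- design. So no entry may be zero, and the supports must partition ℤ/m: `x` gets 1 position, `y`
-- gets `r`, and the j-th complex pair gets `2 k j`. The obstacle is that circulants `E`, `F` of two
-- variables have to satisfy a relation like `E F* + F E* = 0`. Signs alone cannot achieve this, as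
-- `E F*` and `F E*` differ in general. Starring according to the other bits turns the two products
-- into `E F` and `F E`, up to stars that occur equally in both; these agree by commutativity, and
-- then opposite signs suffice. The price is that supports must be invariant under reflection.
-- Besides 0, only a block in the middle is its own mirror image; every other block needs a mirror
-- block, which `D*` fills. This is the origin of the factor 2 at `k j`, both in `m` and in the
-- weights. Both sequences of a pair get a bit of their own, because they also meet each other, in
-- rows with different `κ`.

-ᵍ_ : ℤ[i] → ℤ[i]
-ᵍ (a +i b) = (ℤ.- a) +i (ℤ.- b)

+ᵍ-assoc : ∀ x y z → (x +ᵍ y) +ᵍ z ≡ x +ᵍ (y +ᵍ z)
+ᵍ-assoc x y z = cong₂ _+i_ (ℤₚ.+-assoc (re x) (re y) (re z)) (ℤₚ.+-assoc (im x) (im y) (im z))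

+ᵍ-comm : ∀ x y → x +ᵍ y ≡ y +ᵍ x
+ᵍ-comm x y = cong₂ _+i_ (ℤₚ.+-comm (re x) (re y)) (ℤₚ.+-comm (im x) (im y))

+ᵍ-identityˡ : ∀ x → 0ᵍ +ᵍ x ≡ x
+ᵍ-identityˡ x = cong₂ _+i_ (ℤₚ.+-identityˡ (re x)) (ℤₚ.+-identityˡ (im x))

+ᵍ-identityʳ : ∀ x → x +ᵍ 0ᵍ ≡ x
+ᵍ-identityʳ x = cong₂ _+i_ (ℤₚ.+-identityʳ (re x)) (ℤₚ.+-identityʳ (im x))

+ᵍ-inverseʳ : ∀ x → x +ᵍ (-ᵍ x) ≡ 0ᵍ
+ᵍ-inverseʳ x = cong₂ _+i_ (ℤₚ.+-inverseʳ (re x)) (ℤₚ.+-inverseʳ (im x))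

+ᵍ-inverseˡ : ∀ x → (-ᵍ x) +ᵍ x ≡ 0ᵍ
+ᵍ-inverseˡ x = trans (+ᵍ-comm (-ᵍ x) x) (+ᵍ-inverseʳ x)

+ᵍ-interchange : ∀ w x y z → (w +ᵍ x) +ᵍ (y +ᵍ z) ≡ (w +ᵍ y) +ᵍ (x +ᵍ z)
+ᵍ-interchange w x y z = cong₂ _+i_ (lem (re w) (re x) (re y) (re z)) (lem (im w) (im x) (im y) (im z))
  where
  lem : ∀ a b c d → (a ℤ.+ b) ℤ.+ (c ℤ.+ d) ≡ (a ℤ.+ c) ℤ.+ (b ℤ.+ d)
  lem = solve-∀

+ᵍ-cancelʳ : ∀ x y z → x +ᵍ z ≡ y +ᵍ z → x ≡ y
+ᵍ-cancelʳ x y z eq = begin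
  x                   ≡⟨ lem x ⟩
  (x +ᵍ z) +ᵍ (-ᵍ z)  ≡⟨ cong (_+ᵍ (-ᵍ z)) eq ⟩
  (y +ᵍ z) +ᵍ (-ᵍ z)  ≡⟨ sym (lem y) ⟩
  y                   ∎
  where
  open ≡-Reasoning
  lem : ∀ w → w ≡ (w +ᵍ z) +ᵍ (-ᵍ z)
  lem w = sym (trans (+ᵍ-assoc w z (-ᵍ z)) (trans (cong (w +ᵍ_) (+ᵍ-inverseʳ z)) (+ᵍ-identityʳ w)))

*ᵍ-comm : ∀ x y → x *ᵍ y ≡ y *ᵍ x
*ᵍ-comm x y = cong₂ _+i_ (lem₁ (re x) (im x) (re y) (im y)) (lem₂ (re x) (im x) (re y) (im y))
  where
  lem₁ : ∀ a b c d → a ℤ.* c ℤ.- b ℤ.* d ≡ c ℤ.* a ℤ.- d ℤ.* b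
  lem₁ = solve-∀
  lem₂ : ∀ a b c d → a ℤ.* d ℤ.+ b ℤ.* c ≡ c ℤ.* b ℤ.+ d ℤ.* a
  lem₂ = solve-∀

*ᵍ-distribʳ : ∀ z x y → (x +ᵍ y) *ᵍ z ≡ (x *ᵍ z) +ᵍ (y *ᵍ z)
*ᵍ-distribʳ z x y = cong₂ _+i_ (lem₁ (re x) (im x) (re y) (im y) (re z) (im z)) (lem₂ (re x) (im x) (re y) (im y) (re z) (im z))
  where
  lem₁ : ∀ a b c d e f → (a ℤ.+ c) ℤ.* e ℤ.- (b ℤ.+ d) ℤ.* f ≡ (a ℤ.* e ℤ.- b ℤ.* f) ℤ.+ (c ℤ.* e ℤ.- d ℤ.* f)
  lem₁ = solve-∀
  lem₂ : ∀ a b c d e f → (a ℤ.+ c) ℤ.* f ℤ.+ (b ℤ.+ d) ℤ.* e ≡ (a ℤ.* f ℤ.+ b ℤ.* e) ℤ.+ (c ℤ.* f ℤ.+ d ℤ.* e)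
  lem₂ = solve-∀

*ᵍ-zeroʳ : ∀ x → x *ᵍ 0ᵍ ≡ 0ᵍ
*ᵍ-zeroʳ x = *ᵍ-comm x 0ᵍ

conj-involutive : ∀ x → conj (conj x) ≡ x
conj-involutive x = cong (re x +i_) (ℤₚ.neg-involutive (im x))

conj-+ᵍ : ∀ x y → conj (x +ᵍ y) ≡ conj x +ᵍ conj y
conj-+ᵍ x y = cong ((re x ℤ.+ re y) +i_) (ℤₚ.neg-distrib-+ (im x) (im y))

conj-*ᵍ : ∀ x y → conj (x *ᵍ y) ≡ conj x *ᵍ conj y
conj-*ᵍ x y = cong₂ _+i_ (lem₁ (re x) (im x) (re y) (im y)) (lem₂ (re x) (im x) (re y) (im y))
  where
  lem₁ : ∀ a b c d → a ℤ.* c ℤ.- b ℤ.* d ≡ a ℤ.* c ℤ.- (ℤ.- b) ℤ.* (ℤ.- d)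
  lem₁ = solve-∀
  lem₂ : ∀ a b c d → ℤ.- (a ℤ.* d ℤ.+ b ℤ.* c) ≡ a ℤ.* (ℤ.- d) ℤ.+ (ℤ.- b) ℤ.* c
  lem₂ = solve-∀

*ᵍ-conj-swap : ∀ x y → x *ᵍ conj y ≡ conj (y *ᵍ conj x)
*ᵍ-conj-swap x y = trans (*ᵍ-comm x (conj y))
  (trans (cong (conj y *ᵍ_) (sym (conj-involutive x))) (sym (conj-*ᵍ y (conj x))))

-ᵍ-*ᵍ : ∀ x y → (-ᵍ x) *ᵍ y ≡ -ᵍ (x *ᵍ y)
-ᵍ-*ᵍ x y = cong₂ _+i_ (lem₁ (re x) (im x) (re y) (im y)) (lem₂ (re x) (im x) (re y) (im y))
  where
  lem₁ : ∀ a b c d → (ℤ.- a) ℤ.* c ℤ.- (ℤ.- b) ℤ.* d ≡ ℤ.- (a ℤ.* c ℤ.- b ℤ.* d)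
  lem₁ = solve-∀
  lem₂ : ∀ a b c d → (ℤ.- a) ℤ.* d ℤ.+ (ℤ.- b) ℤ.* c ≡ ℤ.- (a ℤ.* d ℤ.+ b ℤ.* c)
  lem₂ = solve-∀

-ᵍ-involutive : ∀ x → -ᵍ (-ᵍ x) ≡ x
-ᵍ-involutive x = cong₂ _+i_ (ℤₚ.neg-involutive (re x)) (ℤₚ.neg-involutive (im x))

-ᵍ-+ᵍ : ∀ x y → -ᵍ (x +ᵍ y) ≡ (-ᵍ x) +ᵍ (-ᵍ y)
-ᵍ-+ᵍ x y = cong₂ _+i_ (ℤₚ.neg-distrib-+ (re x) (re y)) (ℤₚ.neg-distrib-+ (im x) (im y))

-- The mixed products cancel. Two independent pairs of arguments occur because a correlation
-- compares two shifts. Used with `C` for `x` and `D*` for `y`.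
parallelogram : ∀ x y x′ y′ → ((x +ᵍ y) *ᵍ conj (x′ +ᵍ y′)) +ᵍ ((x +ᵍ (-ᵍ y)) *ᵍ conj (x′ +ᵍ (-ᵍ y′)))
  ≡ ((x *ᵍ conj x′) +ᵍ (y *ᵍ conj y′)) +ᵍ ((x *ᵍ conj x′) +ᵍ (y *ᵍ conj y′))
parallelogram x y x′ y′ = cong₂ _+i_
  (lem₁ (re x) (im x) (re y) (im y) (re x′) (im x′) (re y′) (im y′))
  (lem₂ (re x) (im x) (re y) (im y) (re x′) (im x′) (re y′) (im y′))
  where
  lem₁ : ∀ a b c d a′ b′ c′ d′ →
    ((a ℤ.+ c) ℤ.* (a′ ℤ.+ c′) ℤ.- (b ℤ.+ d) ℤ.* (ℤ.- (b′ ℤ.+ d′))) ℤ.+ ((a ℤ.- c) ℤ.* (a′ ℤ.- c′) ℤ.- (b ℤ.- d) ℤ.* (ℤ.- (b′ ℤ.- d′)))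
    ≡ ((a ℤ.* a′ ℤ.- b ℤ.* (ℤ.- b′)) ℤ.+ (c ℤ.* c′ ℤ.- d ℤ.* (ℤ.- d′))) ℤ.+ ((a ℤ.* a′ ℤ.- b ℤ.* (ℤ.- b′)) ℤ.+ (c ℤ.* c′ ℤ.- d ℤ.* (ℤ.- d′)))
  lem₁ = solve-∀
  lem₂ : ∀ a b c d a′ b′ c′ d′ →
    ((a ℤ.+ c) ℤ.* (ℤ.- (b′ ℤ.+ d′)) ℤ.+ (b ℤ.+ d) ℤ.* (a′ ℤ.+ c′)) ℤ.+ ((a ℤ.- c) ℤ.* (ℤ.- (b′ ℤ.- d′)) ℤ.+ (b ℤ.- d) ℤ.* (a′ ℤ.- c′))
    ≡ ((a ℤ.* (ℤ.- b′) ℤ.+ b ℤ.* a′) ℤ.+ (c ℤ.* (ℤ.- d′) ℤ.+ d ℤ.* c′)) ℤ.+ ((a ℤ.* (ℤ.- b′) ℤ.+ b ℤ.* a′) ℤ.+ (c ℤ.* (ℤ.- d′) ℤ.+ d ℤ.* c′))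
  lem₂ = solve-∀

sgn : Bool → ℤ[i] → ℤ[i]
sgn false x = x
sgn true  x = -ᵍ x

sgn-0ᵍ : ∀ b → sgn b 0ᵍ ≡ 0ᵍ
sgn-0ᵍ false = refl
sgn-0ᵍ true  = refl

sgn-+ᵍ : ∀ b x y → sgn b (x +ᵍ y) ≡ sgn b x +ᵍ sgn b y
sgn-+ᵍ false x y = refl
sgn-+ᵍ true  x y = -ᵍ-+ᵍ x y

sgn-xor : ∀ b c x → sgn (b xor c) x ≡ sgn b (sgn c x)
sgn-xor false c     x = refl
sgn-xor true  false x = refl
sgn-xor true  true  x = sym (-ᵍ-involutive x)

sgn-*ᵍ-conj : ∀ b c x y → sgn b x *ᵍ conj (sgn c y) ≡ sgn (b xor c) (x *ᵍ conj y)
sgn-*ᵍ-conj b c x y = begin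
  sgn b x *ᵍ conj (sgn c y)    ≡⟨ left b (conj (sgn c y)) ⟩
  sgn b (x *ᵍ conj (sgn c y))  ≡⟨ cong (sgn b) (right c) ⟩
  sgn b (sgn c (x *ᵍ conj y))  ≡⟨ sym (sgn-xor b c (x *ᵍ conj y)) ⟩
  sgn (b xor c) (x *ᵍ conj y)  ∎
  where
  open ≡-Reasoning
  left : ∀ b z → sgn b x *ᵍ z ≡ sgn b (x *ᵍ z)
  left false z = refl
  left true  z = -ᵍ-*ᵍ x z
  right : ∀ c → x *ᵍ conj (sgn c y) ≡ sgn c (x *ᵍ conj y)
  right false = refl
  right true  = trans (*ᵍ-comm x (-ᵍ (conj y)))
    (trans (-ᵍ-*ᵍ (conj y) x) (cong -ᵍ_ (*ᵍ-comm (conj y) x)))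

sgn-not-cancel : ∀ b x → sgn (not b) x +ᵍ sgn b x ≡ 0ᵍ
sgn-not-cancel false x = +ᵍ-inverseˡ x
sgn-not-cancel true  x = +ᵍ-inverseʳ x

-- Finite sums

∑-cong : ∀ n {f g : Fin n → ℤ[i]} → (∀ x → f x ≡ g x) → ∑ n f ≡ ∑ n g
∑-cong zero    f≗g = refl
∑-cong (suc n) f≗g = cong₂ _+ᵍ_ (f≗g zero) (∑-cong n (f≗g ∘ suc))

∑-zero : ∀ n {f : Fin n → ℤ[i]} → (∀ x → f x ≡ 0ᵍ) → ∑ n f ≡ 0ᵍ
∑-zero zero    f≗0 = refl
∑-zero (suc n) f≗0 = cong₂ _+ᵍ_ (f≗0 zero) (∑-zero n (f≗0 ∘ suc))

∑-distrib-+ᵍ : ∀ n (f g : Fin n → ℤ[i]) → ∑ n (λ x → f x +ᵍ g x) ≡ ∑ n f +ᵍ ∑ n g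
∑-distrib-+ᵍ zero    f g = refl
∑-distrib-+ᵍ (suc n) f g = trans (cong ((f zero +ᵍ g zero) +ᵍ_) (∑-distrib-+ᵍ n (f ∘ suc) (g ∘ suc)))
  (+ᵍ-interchange (f zero) (g zero) _ _)

∑-sgn : ∀ n b (f : Fin n → ℤ[i]) → ∑ n (λ x → sgn b (f x)) ≡ sgn b (∑ n f)
∑-sgn zero    b f = sym (sgn-0ᵍ b)
∑-sgn (suc n) b f = trans (cong (sgn b (f zero) +ᵍ_) (∑-sgn n b (f ∘ suc))) (sym (sgn-+ᵍ b _ _))

∑-conj : ∀ n (f : Fin n → ℤ[i]) → ∑ n (λ x → conj (f x)) ≡ conj (∑ n f)
∑-conj zero    f = refl
∑-conj (suc n) f = trans (cong (conj (f zero) +ᵍ_) (∑-conj n (f ∘ suc))) (sym (conj-+ᵍ (f zero) (∑ n (f ∘ suc))))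

∑-++ : ∀ m n (f : Fin (m + n) → ℤ[i]) → ∑ (m + n) f ≡ ∑ m (f ∘ (_↑ˡ n)) +ᵍ ∑ n (f ∘ (m ↑ʳ_))
∑-++ zero    n f = sym (+ᵍ-identityˡ _)
∑-++ (suc m) n f = trans (cong (f zero +ᵍ_) (∑-++ m n (f ∘ suc))) (sym (+ᵍ-assoc (f zero) _ _))

∑-combine : ∀ m n (f : Fin (m * n) → ℤ[i]) → ∑ (m * n) f ≡ ∑ m (λ x → ∑ n (λ y → f (combine x y)))
∑-combine zero    n f = refl
∑-combine (suc m) n f = trans (∑-++ n (m * n) f)
  (cong (∑ n (f ∘ (_↑ˡ (m * n))) +ᵍ_) (∑-combine m n (f ∘ (n ↑ʳ_))))

∑< : ℕ → (ℕ → ℤ[i]) → ℤ[i]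
∑< n g = ∑ n (g ∘ toℕ)

∑<-last : ∀ n g → ∑< (suc n) g ≡ ∑< n g +ᵍ g n
∑<-last zero    g = +ᵍ-comm (g 0) 0ᵍ
∑<-last (suc n) g = trans (cong (g 0 +ᵍ_) (∑<-last n (g ∘ suc))) (sym (+ᵍ-assoc (g 0) _ _))

∑<-cong : ∀ n {f g : ℕ → ℤ[i]} → (∀ x → x < n → f x ≡ g x) → ∑< n f ≡ ∑< n g
∑<-cong n f≗g = ∑-cong n (λ x → f≗g (toℕ x) (Finₚ.toℕ<n x))

∑<-pad : ∀ k n {f : ℕ → ℤ[i]} → (∀ x → k ≤ x → f x ≡ 0ᵍ) → ∑< (k + n) f ≡ ∑< k f
∑<-pad zero    n f≗0 = ∑-zero n (λ x → f≗0 (toℕ x) z≤n)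
∑<-pad (suc k) n {f} f≗0 = cong (f 0 +ᵍ_) (∑<-pad k n (λ x k≤x → f≗0 (suc x) (s≤s k≤x)))

-- Periodic functions and their correlations

Periodic : ℕ → (ℤ → ℤ[i]) → Set
Periodic m h = ∀ x → h (x ℤ.+ + m) ≡ h x

∑ᶻ : ℕ → (ℤ → ℤ[i]) → ℤ[i]
∑ᶻ m h = ∑< m (λ u → h (+ u))

∑ᶻ-shift : ∀ m {h} → Periodic m h → ∀ c → ∑ᶻ m (λ u → h (u ℤ.+ c)) ≡ ∑ᶻ m h
∑ᶻ-shift m {h} per = shift
  where
  open ≡-Reasoning
  move : ∀ a c → a ℤ.+ (1ℤ ℤ.+ c) ≡ (1ℤ ℤ.+ a) ℤ.+ c
  move = solve-∀
  wrap : ∀ a c → a ℤ.+ c ≡ (0ℤ ℤ.+ c) ℤ.+ a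
  wrap = solve-∀
  step : ∀ c → ∑ᶻ m (λ u → h (u ℤ.+ (1ℤ ℤ.+ c))) ≡ ∑ᶻ m (λ u → h (u ℤ.+ c))
  -- With `g 0` added, the shifted sum runs over `m + 1` consecutive values, the last of which
  -- equals `g 0` by periodicity.
  step c = +ᵍ-cancelʳ _ _ (g 0) (begin
    ∑ᶻ m (λ u → h (u ℤ.+ (1ℤ ℤ.+ c))) +ᵍ g 0
      ≡⟨ cong (_+ᵍ g 0) (∑<-cong m (λ u _ → cong h (move (+ u) c))) ⟩
    ∑< m (g ∘ suc) +ᵍ g 0  ≡⟨ +ᵍ-comm _ (g 0) ⟩
    ∑< (suc m) g           ≡⟨ ∑<-last m g ⟩
    ∑< m g +ᵍ g m          ≡⟨ cong (∑< m g +ᵍ_) (trans (cong h (wrap (+ m) c)) (per (0ℤ ℤ.+ c))) ⟩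
    ∑< m g +ᵍ g 0          ∎)
    where
    g : ℕ → ℤ[i]
    g u = h (+ u ℤ.+ c)
  shift : ∀ c → ∑ᶻ m (λ u → h (u ℤ.+ c)) ≡ ∑ᶻ m h
  shift (+ zero)         = ∑<-cong m (λ u _ → cong h (ℤₚ.+-identityʳ (+ u)))
  shift (+ suc n)        = trans (step (+ n)) (shift (+ n))
  shift (-[1+ zero ])    = trans (sym (step -[1+ 0 ])) (shift (+ 0))
  shift (-[1+ suc n ])   = trans (sym (step -[1+ suc n ])) (shift -[1+ n ])

∑ᶻ-reflect : ∀ m {h} → Periodic m h → ∀ c → ∑ᶻ m (λ u → h (c ℤ.- u)) ≡ ∑ᶻ m h
∑ᶻ-reflect m {h} per c = trans (rev m c) (∑ᶻ-shift m per (c ℤ.+ (1ℤ ℤ.- + m)))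
  where
  open ≡-Reasoning
  first : ∀ a c → c ℤ.- a ≡ 0ℤ ℤ.+ (c ℤ.+ (1ℤ ℤ.- (1ℤ ℤ.+ a)))
  first = solve-∀
  rest : ∀ u a c → u ℤ.+ (c ℤ.+ (1ℤ ℤ.- a)) ≡ (1ℤ ℤ.+ u) ℤ.+ (c ℤ.+ (1ℤ ℤ.- (1ℤ ℤ.+ a)))
  rest = solve-∀
  -- Reversing the order of summation leaves a window that starts at `c + 1 − n`; periodicity then
  -- moves it back to 0.
  rev : ∀ n c → ∑ᶻ n (λ u → h (c ℤ.- u)) ≡ ∑ᶻ n (λ u → h (u ℤ.+ (c ℤ.+ (1ℤ ℤ.- + n))))
  rev zero    c = refl
  rev (suc n) c = begin
    ∑ᶻ (suc n) (λ u → h (c ℤ.- u))            ≡⟨ ∑<-last n (λ u → h (c ℤ.- + u)) ⟩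
    ∑ᶻ n (λ u → h (c ℤ.- u)) +ᵍ h (c ℤ.- + n) ≡⟨ +ᵍ-comm (∑ᶻ n (λ u → h (c ℤ.- u))) (h (c ℤ.- + n)) ⟩
    h (c ℤ.- + n) +ᵍ ∑ᶻ n (λ u → h (c ℤ.- u))
      ≡⟨ cong₂ _+ᵍ_ (cong h (first (+ n) c))
           (trans (rev n c) (∑<-cong n (λ u _ → cong h (rest (+ u) (+ n) c)))) ⟩
    ∑ᶻ (suc n) (λ u → h (u ℤ.+ (c ℤ.+ (1ℤ ℤ.- + suc n)))) ∎

-- Entry `(t, t′)` of `E F*`, where `E` and `F` are the circulants with entries `e (u − t)` and
-- `f (u − t)` in row `t` and column `u`. In these terms `star` is the conjugate transpose.
corr : ℕ → (ℤ → ℤ[i]) → (ℤ → ℤ[i]) → ℤ → ℤ → ℤ[i]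
corr m e f t t′ = ∑ᶻ m (λ u → e (u ℤ.- t) *ᵍ conj (f (u ℤ.- t′)))

star : (ℤ → ℤ[i]) → ℤ → ℤ[i]
star e x = conj (e (ℤ.- x))

starIf : Bool → (ℤ → ℤ[i]) → ℤ → ℤ[i]
starIf false e = e
starIf true  e = star e

star-involutive : ∀ e x → star (star e) x ≡ e x
star-involutive e x = trans (conj-involutive _) (cong e (ℤₚ.neg-involutive x))

starIf-not : ∀ b e x → starIf (not b) e x ≡ star (starIf b e) x
starIf-not false e x = refl
starIf-not true  e x = sym (star-involutive e x)

periodic-neg : ∀ {m h} → Periodic m h → Periodic m (h ∘ ℤ.-_)
periodic-neg {m} {h} per x = trans (sym (per _)) (cong h (lem x (+ m)))
  where
  lem : ∀ a b → ℤ.- (a ℤ.+ b) ℤ.+ b ≡ ℤ.- a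
  lem = solve-∀

periodic-shift : ∀ {m h} → Periodic m h → ∀ c → Periodic m (λ x → h (x ℤ.- c))
periodic-shift {m} {h} per c x = trans (cong h (lem x (+ m) c)) (per (x ℤ.- c))
  where
  lem : ∀ a b c → (a ℤ.+ b) ℤ.- c ≡ (a ℤ.- c) ℤ.+ b
  lem = solve-∀

periodic-star : ∀ {m e} → Periodic m e → Periodic m (star e)
periodic-star {m} per x = cong conj (periodic-neg {m} per x)

periodic-starIf : ∀ b {m e} → Periodic m e → Periodic m (starIf b e)
periodic-starIf false per = per
periodic-starIf true {m} per = periodic-star {m} per

corr-cong : ∀ m {e e′ f f′} → (∀ x → e x ≡ e′ x) → (∀ x → f x ≡ f′ x) → ∀ t t′ → corr m e f t t′ ≡ corr m e′ f′ t t′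
corr-cong m e≗e′ f≗f′ t t′ = ∑<-cong m (λ u _ → cong₂ (λ x y → x *ᵍ conj y) (e≗e′ (+ u ℤ.- t)) (f≗f′ (+ u ℤ.- t′)))

corr-conj : ∀ m e f t t′ → corr m e f t t′ ≡ conj (corr m f e t′ t)
corr-conj m e f t t′ = trans (∑<-cong m (λ u _ → *ᵍ-conj-swap (e (+ u ℤ.- t)) (f (+ u ℤ.- t′)))) (∑-conj m _)

-- This is `E F = F E` for circulants; the substitution `u ↦ t + t′ − u` exchanges the two factors.
corr-star-swap : ∀ m {e f} → Periodic m e → Periodic m f → ∀ t t′ → corr m e (star f) t t′ ≡ corr m f (star e) t t′
corr-star-swap m {e} {f} pe pf t t′ = begin
  corr m e (star f) t t′            ≡⟨ sym (∑ᶻ-reflect m per (t ℤ.+ t′)) ⟩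
  ∑ᶻ m (λ u → h ((t ℤ.+ t′) ℤ.- u)) ≡⟨ ∑<-cong m (λ u _ → flipped (+ u)) ⟩
  corr m f (star e) t t′            ∎
  where
  open ≡-Reasoning
  h : ℤ → ℤ[i]
  h u = e (u ℤ.- t) *ᵍ conj (star f (u ℤ.- t′))
  per : Periodic m h
  per x = cong₂ (λ a b → a *ᵍ conj b) (periodic-shift {m} pe t x) (periodic-shift {m} (periodic-star {m} pf) t′ x)
  left : ∀ u t t′ → ((t ℤ.+ t′) ℤ.- u) ℤ.- t ≡ ℤ.- (u ℤ.- t′)
  left = solve-∀
  right : ∀ u t t′ → ℤ.- (((t ℤ.+ t′) ℤ.- u) ℤ.- t′) ≡ u ℤ.- t
  right = solve-∀
  flipped : ∀ u → h ((t ℤ.+ t′) ℤ.- u) ≡ f (u ℤ.- t) *ᵍ conj (star e (u ℤ.- t′))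
  flipped u = begin
    h ((t ℤ.+ t′) ℤ.- u)
      ≡⟨ cong₂ _*ᵍ_ (cong e (left u t t′)) (trans (conj-involutive _) (cong f (right u t t′))) ⟩
    e (ℤ.- (u ℤ.- t′)) *ᵍ f (u ℤ.- t)  ≡⟨ *ᵍ-comm (e (ℤ.- (u ℤ.- t′))) (f (u ℤ.- t)) ⟩
    f (u ℤ.- t) *ᵍ e (ℤ.- (u ℤ.- t′))  ≡⟨ cong (f (u ℤ.- t) *ᵍ_) (sym (conj-involutive _)) ⟩
    f (u ℤ.- t) *ᵍ conj (star e (u ℤ.- t′)) ∎

corr-star-star : ∀ m {e} → Periodic m e → ∀ t t′ → corr m (star e) (star e) t t′ ≡ corr m e e t t′
corr-star-star m {e} pe t t′ = trans (corr-star-swap m (periodic-star {m} pe) pe t t′)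
  (corr-cong m {e} (λ _ → refl) (star-involutive e) t t′)

corr-starIf-starIf : ∀ m b {e} → Periodic m e → ∀ t t′ → corr m (starIf b e) (starIf b e) t t′ ≡ corr m e e t t′
corr-starIf-starIf m false pe t t′ = refl
corr-starIf-starIf m true  pe t t′ = corr-star-star m pe t t′

-- Here `b` and `c` stand for the star flags of two bits in a row `ρ`. In the row where both bits
-- are flipped each flag is negated, whence the two occurrences of `not`.
corr-starIf-swap : ∀ m b c {e f} → Periodic m e → Periodic m f → ∀ t t′ →
  corr m (starIf b e) (starIf (not c) f) t t′ ≡ corr m (starIf c f) (starIf (not b) e) t t′
corr-starIf-swap m b c {e} {f} pe pf t t′ = begin
  corr m (starIf b e) (starIf (not c) f) t t′  ≡⟨ corr-cong m {starIf b e} (λ _ → refl) (starIf-not c f) t t′ ⟩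
  corr m (starIf b e) (star (starIf c f)) t t′
    ≡⟨ corr-star-swap m (periodic-starIf b {m} pe) (periodic-starIf c {m} pf) t t′ ⟩
  corr m (starIf c f) (star (starIf b e)) t t′
    ≡⟨ corr-cong m {starIf c f} (λ _ → refl) (λ x → sym (starIf-not b e x)) t t′ ⟩
  corr m (starIf c f) (starIf (not b) e) t t′  ∎
  where open ≡-Reasoning

-- Bit vectors and the Sylvester matrix

isOne : Fin 2 → Bool
isOne zero    = false
isOne (suc _) = true

bits : ∀ p → Fin (2 ^ p) → Vec Bool p
bits zero    _ = []
bits (suc p) x = isOne (proj₁ (remQuot {2} (2 ^ p) x)) ∷ bits p (proj₂ (remQuot {2} (2 ^ p) x))

remQuot-injective : ∀ {m} n {x y : Fin (m * n)} → remQuot {m} n x ≡ remQuot n y → x ≡ y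
remQuot-injective {m} n {x} {y} eq = trans (sym (Finₚ.combine-remQuot {m} n x))
  (trans (cong (λ z → combine (proj₁ z) (proj₂ z)) eq) (Finₚ.combine-remQuot {m} n y))

isOne-injective : ∀ {x y} → isOne x ≡ isOne y → x ≡ y
isOne-injective {zero}     {zero}     _ = refl
isOne-injective {suc zero} {suc zero} _ = refl

bits-injective : ∀ p {x y} → bits p x ≡ bits p y → x ≡ y
bits-injective zero    {zero} {zero} _ = refl
bits-injective (suc p) eq = remQuot-injective {2} (2 ^ p)
  (cong₂ _,_ (isOne-injective (Vecₚ.∷-injectiveˡ eq)) (bits-injective p (Vecₚ.∷-injectiveʳ eq)))

∑ᵇ : ∀ p → (Vec Bool p → ℤ[i]) → ℤ[i]
∑ᵇ p g = ∑ (2 ^ p) (g ∘ bits p)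

∑ᵇ-suc : ∀ p g → ∑ᵇ (suc p) g ≡ ∑ᵇ p (g ∘ (false ∷_)) +ᵍ ∑ᵇ p (g ∘ (true ∷_))
∑ᵇ-suc p g = begin
  ∑ᵇ (suc p) g
    ≡⟨ ∑-combine 2 (2 ^ p) (g ∘ bits (suc p)) ⟩
  ∑ 2 (λ x → ∑ (2 ^ p) (λ y → g (bits (suc p) (combine x y))))
    ≡⟨ ∑-cong 2 (λ x → ∑-cong (2 ^ p) (λ y → cong (λ z → g (isOne (proj₁ z) ∷ bits p (proj₂ z)))
         (Finₚ.remQuot-combine {2} x y))) ⟩
  ∑ 2 (λ x → ∑ᵇ p (g ∘ (isOne x ∷_)))
    ≡⟨ cong (∑ᵇ p (g ∘ (false ∷_)) +ᵍ_) (+ᵍ-identityʳ (∑ᵇ p (g ∘ (true ∷_)))) ⟩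
  ∑ᵇ p (g ∘ (false ∷_)) +ᵍ ∑ᵇ p (g ∘ (true ∷_)) ∎
  where open ≡-Reasoning

∑ᵇ-cong : ∀ p {f g : Vec Bool p → ℤ[i]} → (∀ γ → f γ ≡ g γ) → ∑ᵇ p f ≡ ∑ᵇ p g
∑ᵇ-cong p f≗g = ∑-cong (2 ^ p) (λ x → f≗g (bits p x))

∑ᵇ-const : ∀ p w → ∑ᵇ p (λ _ → fromℕᵍ w) ≡ fromℕᵍ (2 ^ p * w)
∑ᵇ-const zero    w = trans (+ᵍ-identityʳ (fromℕᵍ w)) (cong fromℕᵍ (sym (ℕₚ.*-identityˡ w)))
∑ᵇ-const (suc p) w = begin
  ∑ᵇ (suc p) (λ _ → fromℕᵍ w)                           ≡⟨ ∑ᵇ-suc p (λ _ → fromℕᵍ w) ⟩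
  ∑ᵇ p (λ _ → fromℕᵍ w) +ᵍ ∑ᵇ p (λ _ → fromℕᵍ w)        ≡⟨ cong₂ _+ᵍ_ (∑ᵇ-const p w) (∑ᵇ-const p w) ⟩
  fromℕᵍ (2 ^ p * w + 2 ^ p * w)                        ≡⟨ cong fromℕᵍ (sym (ℕₚ.*-distribʳ-+ w (2 ^ p) (2 ^ p))) ⟩
  fromℕᵍ ((2 ^ p + 2 ^ p) * w)                          ≡⟨ cong (λ z → fromℕᵍ ((2 ^ p + z) * w)) (sym (ℕₚ.+-identityʳ (2 ^ p))) ⟩
  fromℕᵍ (2 ^ suc p * w)                                ∎
  where open ≡-Reasoning

dot : ∀ {p} → Vec Bool p → Vec Bool p → Bool
dot []      []      = false
dot (b ∷ c) (g ∷ γ) = (b ∧ g) xor dot c γ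

-- The sign given by `dot c γ` is the entry of the Sylvester matrix in row `c` and column `γ`, so
-- this is the inner product of two of its rows, scaled by `z`.
rowProduct : ∀ {p} → Vec Bool p → Vec Bool p → ℤ[i] → ℤ[i]
rowProduct {p} c c′ z = ∑ᵇ p (λ γ → sgn (dot c γ xor dot c′ γ) z)

rowProduct-same : ∀ {p} (c : Vec Bool p) z → rowProduct c c z ≡ ∑ᵇ p (λ _ → z)
rowProduct-same {p} c z = ∑ᵇ-cong p (λ γ → cong (λ b → sgn b z) (Boolₚ.xor-same (dot c γ)))

rowProduct-distinct : ∀ {p} (c c′ : Vec Bool p) z → c ≢ c′ → rowProduct c c′ z ≡ 0ᵍ
rowProduct-distinct []      []         z c≢c′ = ⊥-elim (c≢c′ refl)
rowProduct-distinct {suc p} (b ∷ c) (b′ ∷ c′) z c≢c′ =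
  trans (∑ᵇ-suc p (λ γ → sgn (dot (b ∷ c) γ xor dot (b′ ∷ c′) γ) z)) (trans (cong₂ _+ᵍ_ (half b b′ false) (half b b′ true)) (cancel b b′ c≢c′))
  where
  open CommutativeSemigroupₚ (CommutativeRing.+-commutativeSemigroup Boolₚ.xor-∧-commutativeRing) using (interchange)
  half : ∀ b b′ g → ∑ᵇ p (λ γ → sgn (dot (b ∷ c) (g ∷ γ) xor dot (b′ ∷ c′) (g ∷ γ)) z)
    ≡ sgn ((b ∧ g) xor (b′ ∧ g)) (rowProduct c c′ z)
  half b b′ g = trans
    (∑ᵇ-cong p (λ γ → trans (cong (λ s → sgn s z) (interchange (b ∧ g) (dot c γ) (b′ ∧ g) (dot c′ γ)))
      (sgn-xor ((b ∧ g) xor (b′ ∧ g)) (dot c γ xor dot c′ γ) z)))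
    (∑-sgn (2 ^ p) ((b ∧ g) xor (b′ ∧ g)) _)
  -- For equal leading bits the tails differ and both halves vanish by induction; for different ones
  -- the halves are negatives of each other.
  cancel : ∀ b b′ → b ∷ c ≢ b′ ∷ c′ →
    sgn ((b ∧ false) xor (b′ ∧ false)) (rowProduct c c′ z) +ᵍ sgn ((b ∧ true) xor (b′ ∧ true)) (rowProduct c c′ z) ≡ 0ᵍ
  cancel false false ne = cong₂ _+ᵍ_ (rowProduct-distinct c c′ z (ne ∘ cong (false ∷_))) (rowProduct-distinct c c′ z (ne ∘ cong (false ∷_)))
  cancel false true  ne = sgn-not-cancel true (rowProduct c c′ z)
  cancel true  false ne = sgn-not-cancel true (rowProduct c c′ z)
  cancel true  true  ne = cong₂ _+ᵍ_ (rowProduct-distinct c c′ z (ne ∘ cong (true ∷_))) (rowProduct-distinct c c′ z (ne ∘ cong (true ∷_)))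

-- Signs and stars of the anticommuting family

toggle : ∀ {p} → Fin p → Vec Bool p → Vec Bool p
toggle l ρ = updateAt ρ l not

toggle-involutive : ∀ {p} (l : Fin p) ρ → toggle l (toggle l ρ) ≡ ρ
toggle-involutive zero    (b ∷ ρ) = cong (_∷ ρ) (Boolₚ.not-involutive b)
toggle-involutive (suc l) (b ∷ ρ) = cong (b ∷_) (toggle-involutive l ρ)

-- If `l` and `l′` lead two rows to the same column, then so do `l′` and `l`. Hence the two terms
-- that should cancel are either both present or both absent.
toggle-transpose : ∀ {p} {l l′ : Fin p} {ρ ρ′} → l ≢ l′ → toggle l ρ ≡ toggle l′ ρ′ → toggle l′ ρ ≡ toggle l ρ′
toggle-transpose {l = l} {l′} {ρ} {ρ′} l≢l′ eq = begin
  toggle l′ ρ                            ≡⟨ cong (toggle l′) (sym (toggle-involutive l ρ)) ⟩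
  toggle l′ (toggle l (toggle l ρ))      ≡⟨ sym (Vecₚ.updateAt-commutes l l′ l≢l′ (toggle l ρ)) ⟩
  toggle l (toggle l′ (toggle l ρ))      ≡⟨ cong (toggle l ∘ toggle l′) eq ⟩
  toggle l (toggle l′ (toggle l′ ρ′))    ≡⟨ cong (toggle l) (toggle-involutive l′ ρ′) ⟩
  toggle l ρ′                            ∎
  where open ≡-Reasoning

parity : ∀ {p} → Vec Bool p → Bool
parity []      = false
parity (b ∷ ρ) = b xor parity ρ

-- The Jordan-Wigner sign, which makes flips of distinct bits anticommute.
prefixParity : ∀ {p} → Fin p → Vec Bool p → Bool
prefixParity zero    _       = false
prefixParity (suc l) (b ∷ ρ) = b xor prefixParity l ρ

-- The second summand removes bit `l` from the parity, so flipping `l` leaves the value alone while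
-- flipping any other bit negates it.
otherParity : ∀ {p} → Fin p → Vec Bool p → Bool
otherParity l ρ = parity ρ xor lookup ρ l

xor-notʳ : ∀ b c → b xor not c ≡ not (b xor c)
xor-notʳ false c = refl
xor-notʳ true  c = refl

not-xor : ∀ b c → not b xor c ≡ not (b xor c)
not-xor false c = refl
not-xor true  c = sym (Boolₚ.not-involutive c)

xor-cancelˡ : ∀ b x y → (b xor x) xor (b xor y) ≡ x xor y
xor-cancelˡ false x y = refl
xor-cancelˡ true  x y = trans (not-xor x (not y)) (trans (cong not (xor-notʳ x y)) (Boolₚ.not-involutive (x xor y)))

parity-toggle : ∀ {p} (l : Fin p) ρ → parity (toggle l ρ) ≡ not (parity ρ)
parity-toggle zero    (b ∷ ρ) = not-xor b (parity ρ)
parity-toggle (suc l) (b ∷ ρ) = trans (cong (b xor_) (parity-toggle l ρ)) (xor-notʳ b (parity ρ))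

otherParity-toggle : ∀ {p} {l l′ : Fin p} ρ → l ≢ l′ → otherParity l (toggle l (toggle l′ ρ)) ≡ not (otherParity l ρ)
otherParity-toggle {l = l} {l′} ρ l≢l′ = trans (cong₂ _xor_ par lk) (xor-notʳ (parity ρ) (lookup ρ l))
  where
  par : parity (toggle l (toggle l′ ρ)) ≡ parity ρ
  par = trans (parity-toggle l (toggle l′ ρ)) (trans (cong not (parity-toggle l′ ρ)) (Boolₚ.not-involutive (parity ρ)))
  lk : lookup (toggle l (toggle l′ ρ)) l ≡ not (lookup ρ l)
  lk = trans (Vecₚ.lookup∘updateAt l (toggle l′ ρ)) (cong not (Vecₚ.lookup∘updateAt′ l l′ l≢l′ ρ))

prefixParity-toggle : ∀ {p} (l : Fin p) ρ → prefixParity l (toggle l ρ) ≡ prefixParity l ρ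
prefixParity-toggle zero    ρ       = refl
prefixParity-toggle (suc l) (b ∷ ρ) = cong (b xor_) (prefixParity-toggle l ρ)

-- Of two distinct bits exactly one precedes the other, so exactly one of the two prefixes notices
-- the flip of the other bit.
prefixParity-anticommute : ∀ {p} {l l′ : Fin p} ρ → l ≢ l′ →
  prefixParity l ρ xor prefixParity l′ (toggle l′ (toggle l ρ))
    ≡ not (prefixParity l′ ρ xor prefixParity l (toggle l′ (toggle l ρ)))
prefixParity-anticommute {l = zero}  {zero}   ρ       l≢l′ = ⊥-elim (l≢l′ refl)
prefixParity-anticommute {l = zero}  {suc l′} (b ∷ ρ) l≢l′ = begin
  not b xor prefixParity l′ (toggle l′ ρ)     ≡⟨ cong (not b xor_) (prefixParity-toggle l′ ρ) ⟩
  not b xor prefixParity l′ ρ                 ≡⟨ not-xor b _ ⟩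
  not (b xor prefixParity l′ ρ)               ≡⟨ cong not (sym (Boolₚ.xor-identityʳ _)) ⟩
  not ((b xor prefixParity l′ ρ) xor false)   ∎
  where open ≡-Reasoning
prefixParity-anticommute {l = suc l} {zero}   (b ∷ ρ) l≢l′ = begin
  (b xor prefixParity l ρ) xor false              ≡⟨ Boolₚ.xor-identityʳ _ ⟩
  b xor prefixParity l ρ                          ≡⟨ cong (b xor_) (sym (prefixParity-toggle l ρ)) ⟩
  b xor prefixParity l (toggle l ρ)               ≡⟨ sym (Boolₚ.not-involutive _) ⟩
  not (not (b xor prefixParity l (toggle l ρ)))   ≡⟨ cong not (sym (not-xor b _)) ⟩
  not (not b xor prefixParity l (toggle l ρ))     ∎
  where open ≡-Reasoning
prefixParity-anticommute {l = suc l} {suc l′} (b ∷ ρ) l≢l′ =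
  trans (xor-cancelˡ b (prefixParity l ρ) _)
    (trans (prefixParity-anticommute ρ (l≢l′ ∘ cong suc)) (cong not (sym (xor-cancelˡ b (prefixParity l′ ρ) _))))

-- The design

entryCoeff : ∀ {v} → Entry v → Fin v → ℤ[i]
entryCoeff zer       s = 0ᵍ
entryCoeff (var w j) s = if eqᶠ j s then unitVal w else 0ᵍ

contrib≡ : ∀ {v} (x y : Entry v) s t → contrib x y s t ≡ entryCoeff x s *ᵍ conj (entryCoeff y t)
contrib≡ zer       y         s t = refl
contrib≡ (var u j) zer       s t = sym (*ᵍ-zeroʳ (entryCoeff (var u j) s))
contrib≡ (var u j) (var w l) s t with eqᶠ j s | eqᶠ l t
... | true  | true  = refl
... | true  | false = sym (*ᵍ-zeroʳ (unitVal u))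
... | false | true  = refl
... | false | false = refl

-- Disjointness of supports, stated at a single position: only the variable `j₀` may have a nonzero
-- coefficient there. Naming `j₀` replaces a comparison of all pairs of variables.
data Fits {v : ℕ} (j₀ j : Fin v) (z : ℤ[i]) : Set where
  vanishes : z ≡ 0ᵍ → Fits j₀ j z
  isUnit   : j₀ ≡ j → (w : Unit4) → z ≡ unitVal w → Fits j₀ j z

fits-neg : ∀ {v} {j₀ j : Fin v} {z} → Fits j₀ j z → Fits j₀ j (-ᵍ z)
fits-neg (vanishes refl)       = vanishes refl
fits-neg (isUnit eq one  refl) = isUnit eq mone refl
fits-neg (isUnit eq i    refl) = isUnit eq mi refl
fits-neg (isUnit eq mone refl) = isUnit eq one refl
fits-neg (isUnit eq mi   refl) = isUnit eq i refl

fits-conj : ∀ {v} {j₀ j : Fin v} {z} → Fits j₀ j z → Fits j₀ j (conj z)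
fits-conj (vanishes refl)       = vanishes refl
fits-conj (isUnit eq one  refl) = isUnit eq one refl
fits-conj (isUnit eq i    refl) = isUnit eq mi refl
fits-conj (isUnit eq mone refl) = isUnit eq mone refl
fits-conj (isUnit eq mi   refl) = isUnit eq i refl

fits-sgn : ∀ {v} {j₀ j : Fin v} b {z} → Fits j₀ j z → Fits j₀ j (sgn b z)
fits-sgn false fit = fit
fits-sgn true  fit = fits-neg fit

toEntry : ∀ {v} (j₀ : Fin v) (f : Fin v → ℤ[i]) → (∀ j → Fits j₀ j (f j)) →
  ∃ λ x → ∀ j → entryCoeff x j ≡ f j
toEntry j₀ f fits with fits j₀
... | vanishes f₀≡0 = zer , λ j → sym (allZero j (fits j))
  where
  allZero : ∀ j → Fits j₀ j (f j) → f j ≡ 0ᵍ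
  allZero j (vanishes eq)     = eq
  allZero j (isUnit refl _ _) = f₀≡0
... | isUnit _ w f₀≡w = var w j₀ , value
  where
  value : ∀ j → entryCoeff (var w j₀) j ≡ f j
  value j with j₀ ≟ j
  ... | yes refl = sym f₀≡w
  ... | no  j₀≢j with fits j
  ...   | vanishes eq      = sym eq
  ...   | isUnit j₀≡j _ _  = ⊥-elim (j₀≢j j₀≡j)

-- `weight j` is the constant value of `ee* + ff*` for the pair of variable `j`. The variable named
-- by `region` depends on the position alone, so it serves both sequences of a pair, and by
-- `region-neg` also their stars.
record Sequences (v m : ℕ) (weight : Fin v → ℕ) : Set where
  field
    seq         : Fin v → Bool → ℤ → ℤ[i]
    periodic    : ∀ j τ → Periodic m (seq j τ)
    complementary : ∀ j (t t′ : Fin m) →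
      corr m (seq j false) (seq j false) (+ toℕ t) (+ toℕ t′) +ᵍ corr m (seq j true) (seq j true) (+ toℕ t) (+ toℕ t′)
        ≡ (if eqᶠ t t′ then fromℕᵍ (weight j) else 0ᵍ)
    region      : ℤ → Fin v
    region-neg  : ∀ x → region (ℤ.- x) ≡ region x
    fits        : ∀ j τ x → Fits (region x) j (seq j τ x)

-- `slot` gives each of the `2v` sequences its own bit, that is, its own member of the anticommuting
-- family.
module Design {v m p : ℕ} {weight : Fin v → ℕ} (S : Sequences v m weight)
  (slot : Fin v → Bool → Fin p)
  (slot-injective : ∀ {j τ j′ τ′} → slot j τ ≡ slot j′ τ′ → j ≡ j′ × τ ≡ τ′) where

  open Sequences S
  open ≡-Reasoning

  N : ℕ
  N = 2 ^ suc p * m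

  starred : Fin v → Bool → Vec Bool p → ℤ → ℤ[i]
  starred j τ ρ = starIf (otherParity (slot j τ) ρ) (seq j τ)

  fits-starred : ∀ j τ ρ x → Fits (region x) j (starred j τ ρ x)
  fits-starred j τ ρ x with otherParity (slot j τ) ρ
  ... | false = fits j τ x
  ... | true  = subst (λ j₀ → Fits j₀ j (star (seq j τ) x)) (region-neg x) (fits-conj (fits j τ (ℤ.- x)))

  -- Row `ρ` of `Uₗ` has a single nonzero block, in column `toggle l ρ`. Multiplying on the right by
  -- the Sylvester matrix therefore picks row `toggle l ρ` of that matrix.
  value : Fin v → Bool → Vec Bool p → Fin m → Vec Bool p → Fin m → ℤ[i]
  value j τ ρ t γ u = sgn (prefixParity (slot j τ) ρ xor dot (toggle (slot j τ) ρ) γ)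
    (starred j τ ρ (+ toℕ u ℤ.- + toℕ t))

  Index : Set
  Index = Vec Bool (suc p) × Fin m

  -- The leading bits of row and column decide which sequence of the pair is used.
  coefficient : Fin v → Index → Index → ℤ[i]
  coefficient j (κ ∷ ρ , t) (κ′ ∷ γ , u) = value j (κ xor κ′) ρ t γ u

  fits-coefficient : ∀ a b → ∃ λ j₀ → ∀ j → Fits j₀ j (coefficient j a b)
  fits-coefficient (κ ∷ ρ , t) (κ′ ∷ γ , u) = region (+ toℕ u ℤ.- + toℕ t) , λ j →
    fits-sgn (prefixParity (slot j (κ xor κ′)) ρ xor dot (toggle (slot j (κ xor κ′)) ρ) γ) (fits-starred j (κ xor κ′) ρ _)

  decode : Fin N → Index
  decode a = bits (suc p) (proj₁ (remQuot {2 ^ suc p} m a)) , proj₂ (remQuot {2 ^ suc p} m a)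

  decode-injective : ∀ {a b} → decode a ≡ decode b → a ≡ b
  decode-injective eq = remQuot-injective {2 ^ suc p} m
    (cong₂ _,_ (bits-injective (suc p) (cong proj₁ eq)) (cong proj₂ eq))

  entryAt : ∀ a b → ∃ λ x → ∀ j → entryCoeff x j ≡ coefficient j (decode a) (decode b)
  entryAt a b = toEntry (proj₁ fc) (λ j → coefficient j (decode a) (decode b)) (proj₂ fc)
    where fc = fits-coefficient (decode a) (decode b)

  X : Fin N → Fin N → Entry v
  X a b = proj₁ (entryAt a b)

  term : Fin v → Bool → Vec Bool p → Fin m → Fin v → Bool → Vec Bool p → Fin m → ℤ[i]
  term j τ ρ t j′ τ′ ρ′ t′ = ∑ᵇ p (λ γ → ∑ m (λ u → value j τ ρ t γ u *ᵍ conj (value j′ τ′ ρ′ t′ γ u)))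

  rowSum : Fin v → Index → Fin v → Index → ℤ[i]
  rowSum j (κ ∷ ρ , t) j′ (κ′ ∷ ρ′ , t′) =
    term j (κ xor false) ρ t j′ (κ′ xor false) ρ′ t′ +ᵍ term j (κ xor true) ρ t j′ (κ′ xor true) ρ′ t′

  ordCoeff≡ : ∀ a b j j′ → ordCoeff X a b j j′ ≡ rowSum j (decode a) j′ (decode b)
  ordCoeff≡ a b j j′ = begin
    ordCoeff X a b j j′
      ≡⟨ ∑-cong N (λ l → trans (contrib≡ (X a l) (X b l) j j′)
           (cong₂ (λ x y → x *ᵍ conj y) (proj₂ (entryAt a l) j) (proj₂ (entryAt b l) j′))) ⟩
    ∑ N (λ l → product (decode a) (decode b) (decode l))
      ≡⟨ ∑-combine (2 ^ suc p) m _ ⟩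
    ∑ (2 ^ suc p) (λ x → ∑ m (λ u → product (decode a) (decode b) (decode (combine x u))))
      ≡⟨ ∑-cong (2 ^ suc p) (λ x → ∑-cong m (λ u → cong (product (decode a) (decode b)) (decode-combine x u))) ⟩
    ∑ᵇ (suc p) (λ g → ∑ m (λ u → product (decode a) (decode b) (g , u)))
      ≡⟨ ∑ᵇ-suc p (λ g → ∑ m (λ u → product (decode a) (decode b) (g , u))) ⟩
    ∑ᵇ p (λ γ → ∑ m (λ u → product (decode a) (decode b) (false ∷ γ , u))) +ᵍ
      ∑ᵇ p (λ γ → ∑ m (λ u → product (decode a) (decode b) (true ∷ γ , u)))
      ∎
    where
    product : Index → Index → Index → ℤ[i]
    product a b l = coefficient j a l *ᵍ conj (coefficient j′ b l)
    decode-combine : ∀ x u → decode (combine x u) ≡ (bits (suc p) x , u)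
    decode-combine x u = cong (λ z → bits (suc p) (proj₁ z) , proj₂ z) (Finₚ.remQuot-combine {2 ^ suc p} x u)

  starredCorr : Fin v → Bool → Vec Bool p → Fin m → Fin v → Bool → Vec Bool p → Fin m → ℤ[i]
  starredCorr j τ ρ t j′ τ′ ρ′ t′ = corr m (starred j τ ρ) (starred j′ τ′ ρ′) (+ toℕ t) (+ toℕ t′)

  -- No sign depends on the position `u`, so the product splits into a Jordan-Wigner sign, an inner
  -- product of Sylvester rows and a correlation of circulants.
  term≡ : ∀ j τ ρ t j′ τ′ ρ′ t′ → term j τ ρ t j′ τ′ ρ′ t′ ≡
    sgn (prefixParity (slot j τ) ρ xor prefixParity (slot j′ τ′) ρ′)
      (rowProduct (toggle (slot j τ) ρ) (toggle (slot j′ τ′) ρ′) (starredCorr j τ ρ t j′ τ′ ρ′ t′))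
  term≡ j τ ρ t j′ τ′ ρ′ t′ = begin
    term j τ ρ t j′ τ′ ρ′ t′
      ≡⟨ ∑ᵇ-cong p (λ γ → ∑-cong m (pointwise γ)) ⟩
    ∑ᵇ p (λ γ → ∑ m (λ u → sgn outer (sgn (inner γ) (product u))))
      ≡⟨ ∑ᵇ-cong p (λ γ → trans (∑-sgn m outer (λ u → sgn (inner γ) (product u))) (cong (sgn outer) (∑-sgn m (inner γ) product))) ⟩
    ∑ᵇ p (λ γ → sgn outer (sgn (inner γ) (∑ m product)))
      ≡⟨ ∑-sgn (2 ^ p) outer (λ x → sgn (inner (bits p x)) (∑ m product)) ⟩
    sgn outer (rowProduct c c′ (starredCorr j τ ρ t j′ τ′ ρ′ t′)) ∎
    where
    open CommutativeSemigroupₚ (CommutativeRing.+-commutativeSemigroup Boolₚ.xor-∧-commutativeRing) using (interchange)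
    c c′ : Vec Bool p
    c = toggle (slot j τ) ρ
    c′ = toggle (slot j′ τ′) ρ′
    outer : Bool
    outer = prefixParity (slot j τ) ρ xor prefixParity (slot j′ τ′) ρ′
    inner : Vec Bool p → Bool
    inner γ = dot c γ xor dot c′ γ
    product : Fin m → ℤ[i]
    product u = starred j τ ρ (+ toℕ u ℤ.- + toℕ t) *ᵍ conj (starred j′ τ′ ρ′ (+ toℕ u ℤ.- + toℕ t′))
    pointwise : ∀ γ u → value j τ ρ t γ u *ᵍ conj (value j′ τ′ ρ′ t′ γ u) ≡ sgn outer (sgn (inner γ) (product u))
    pointwise γ u = trans
      (sgn-*ᵍ-conj (prefixParity (slot j τ) ρ xor dot c γ) (prefixParity (slot j′ τ′) ρ′ xor dot c′ γ) _ _)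
      (trans (cong (λ b → sgn b (product u)) (interchange (prefixParity (slot j τ) ρ) (dot c γ) _ (dot c′ γ)))
        (sgn-xor outer (inner γ) (product u)))

  term-distinct : ∀ j τ ρ t j′ τ′ ρ′ t′ → toggle (slot j τ) ρ ≢ toggle (slot j′ τ′) ρ′ → term j τ ρ t j′ τ′ ρ′ t′ ≡ 0ᵍ
  term-distinct j τ ρ t j′ τ′ ρ′ t′ ne = trans (term≡ j τ ρ t j′ τ′ ρ′ t′)
    (trans (cong (sgn outer) (rowProduct-distinct _ _ _ ne)) (sgn-0ᵍ outer))
    where outer = prefixParity (slot j τ) ρ xor prefixParity (slot j′ τ′) ρ′

  term-equal : ∀ j τ ρ t j′ τ′ ρ′ t′ → toggle (slot j τ) ρ ≡ toggle (slot j′ τ′) ρ′ → term j τ ρ t j′ τ′ ρ′ t′ ≡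
    sgn (prefixParity (slot j τ) ρ xor prefixParity (slot j′ τ′) ρ′) (∑ᵇ p (λ _ → starredCorr j τ ρ t j′ τ′ ρ′ t′))
  term-equal j τ ρ t j′ τ′ ρ′ t′ eq = trans (term≡ j τ ρ t j′ τ′ ρ′ t′)
    (cong (sgn (prefixParity (slot j τ) ρ xor prefixParity (slot j′ τ′) ρ′))
      (trans (cong (λ c → rowProduct c (toggle (slot j′ τ′) ρ′) (starredCorr j τ ρ t j′ τ′ ρ′ t′)) eq) (rowProduct-same (toggle (slot j′ τ′) ρ′) _)))

  -- This is the relation `Uₗ Uₗ′* + Uₗ′ Uₗ* = 0`. Either both terms vanish by orthogonality of
  -- Sylvester rows, or `ρ′` is `ρ` with both bits flipped; then the correlations agree, since
  -- circulants commute, and the signs are opposite.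
  term-anticommute : ∀ j τ j′ τ′ ρ t ρ′ t′ → slot j τ ≢ slot j′ τ′ →
    term j τ ρ t j′ τ′ ρ′ t′ +ᵍ term j′ τ′ ρ t j τ ρ′ t′ ≡ 0ᵍ
  term-anticommute j τ j′ τ′ ρ t ρ′ t′ l≢l′ with Vecₚ.≡-dec Boolₚ._≟_ (toggle (slot j τ) ρ) (toggle (slot j′ τ′) ρ′)
  ... | no ne = cong₂ _+ᵍ_ (term-distinct j τ ρ t j′ τ′ ρ′ t′ ne)
    (term-distinct j′ τ′ ρ t j τ ρ′ t′ (ne ∘ toggle-transpose (l≢l′ ∘ sym)))
  ... | yes eq = begin
    term j τ ρ t j′ τ′ ρ′ t′ +ᵍ term j′ τ′ ρ t j τ ρ′ t′
      ≡⟨ cong₂ _+ᵍ_ (term-equal j τ ρ t j′ τ′ ρ′ t′ eq) (term-equal j′ τ′ ρ t j τ ρ′ t′ (toggle-transpose l≢l′ eq)) ⟩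
    sgn (prefixParity l ρ xor prefixParity l′ ρ′) (∑ᵇ p (λ _ → starredCorr j τ ρ t j′ τ′ ρ′ t′)) +ᵍ sgn b (∑ᵇ p (λ _ → starredCorr j′ τ′ ρ t j τ ρ′ t′))
      ≡⟨ cong (_+ᵍ sgn b (∑ᵇ p (λ _ → starredCorr j′ τ′ ρ t j τ ρ′ t′)))
           (cong₂ sgn signs (∑ᵇ-cong p (λ _ → corrs))) ⟩
    sgn (not b) (∑ᵇ p (λ _ → starredCorr j′ τ′ ρ t j τ ρ′ t′)) +ᵍ sgn b (∑ᵇ p (λ _ → starredCorr j′ τ′ ρ t j τ ρ′ t′))
      ≡⟨ sgn-not-cancel b _ ⟩
    0ᵍ ∎
    where
    l l′ : Fin p
    l = slot j τ
    l′ = slot j′ τ′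
    b : Bool
    b = prefixParity l′ ρ xor prefixParity l ρ′
    ρ′≡ : ρ′ ≡ toggle l′ (toggle l ρ)
    ρ′≡ = trans (sym (toggle-involutive l′ ρ′)) (cong (toggle l′) (sym eq))
    ρ′≡′ : ρ′ ≡ toggle l (toggle l′ ρ)
    ρ′≡′ = trans (sym (toggle-involutive l ρ′)) (cong (toggle l) (sym (toggle-transpose l≢l′ eq)))
    signs : prefixParity l ρ xor prefixParity l′ ρ′ ≡ not b
    signs = subst (λ σ → prefixParity l ρ xor prefixParity l′ σ ≡ not (prefixParity l′ ρ xor prefixParity l σ)) (sym ρ′≡)
      (prefixParity-anticommute ρ l≢l′)
    star′ : otherParity l′ ρ′ ≡ not (otherParity l′ ρ)
    star′ = trans (cong (otherParity l′) ρ′≡) (otherParity-toggle ρ (l≢l′ ∘ sym))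
    star″ : otherParity l ρ′ ≡ not (otherParity l ρ)
    star″ = trans (cong (otherParity l) ρ′≡′) (otherParity-toggle ρ l≢l′)
    corrs : starredCorr j τ ρ t j′ τ′ ρ′ t′ ≡ starredCorr j′ τ′ ρ t j τ ρ′ t′
    corrs = begin
      starredCorr j τ ρ t j′ τ′ ρ′ t′
        ≡⟨ cong (λ s → corr m (starred j τ ρ) (starIf s (seq j′ τ′)) (+ toℕ t) (+ toℕ t′)) star′ ⟩
      corr m (starred j τ ρ) (starIf (not (otherParity l′ ρ)) (seq j′ τ′)) (+ toℕ t) (+ toℕ t′)
        ≡⟨ corr-starIf-swap m (otherParity l ρ) (otherParity l′ ρ) (periodic j τ) (periodic j′ τ′) (+ toℕ t) (+ toℕ t′) ⟩
      corr m (starred j′ τ′ ρ) (starIf (not (otherParity l ρ)) (seq j τ)) (+ toℕ t) (+ toℕ t′)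
        ≡⟨ cong (λ s → corr m (starred j′ τ′ ρ) (starIf s (seq j τ)) (+ toℕ t) (+ toℕ t′)) (sym star″) ⟩
      starredCorr j′ τ′ ρ t j τ ρ′ t′ ∎

  term-diagonal : ∀ j τ ρ t t′ → term j τ ρ t j τ ρ t′ ≡ ∑ᵇ p (λ _ → corr m (seq j τ) (seq j τ) (+ toℕ t) (+ toℕ t′))
  term-diagonal j τ ρ t t′ = trans (term-equal j τ ρ t j τ ρ t′ refl)
    (cong₂ sgn (Boolₚ.xor-same (prefixParity (slot j τ) ρ))
      (∑ᵇ-cong p (λ _ → corr-starIf-starIf m (otherParity (slot j τ) ρ) (periodic j τ) (+ toℕ t) (+ toℕ t′))))

  -- `T τ τ′` cancels against `T′ τ′ τ`. The partners occur in the same order if `κ` and `κ′` agree,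
  -- and in reversed order otherwise.
  rowSum-cross : ∀ {j j′} → j ≢ j′ → ∀ a b → rowSum j a j′ b +ᵍ rowSum j′ a j b ≡ 0ᵍ
  rowSum-cross {j} {j′} j≢j′ (κ ∷ ρ , t) (κ′ ∷ ρ′ , t′) = cases κ κ′
    where
    T T′ : Bool → Bool → ℤ[i]
    T  τ τ′ = term j τ ρ t j′ τ′ ρ′ t′
    T′ τ τ′ = term j′ τ ρ t j τ′ ρ′ t′
    anti : ∀ τ τ′ → T τ τ′ +ᵍ T′ τ′ τ ≡ 0ᵍ
    anti τ τ′ = term-anticommute j τ j′ τ′ ρ t ρ′ t′ (j≢j′ ∘ proj₁ ∘ slot-injective)
    straight : ∀ τ τ′ σ σ′ → (T τ τ′ +ᵍ T σ σ′) +ᵍ (T′ τ′ τ +ᵍ T′ σ′ σ) ≡ 0ᵍ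
    straight τ τ′ σ σ′ = trans (+ᵍ-interchange (T τ τ′) (T σ σ′) (T′ τ′ τ) (T′ σ′ σ)) (cong₂ _+ᵍ_ (anti τ τ′) (anti σ σ′))
    crossed : ∀ τ τ′ σ σ′ → (T τ τ′ +ᵍ T σ σ′) +ᵍ (T′ σ′ σ +ᵍ T′ τ′ τ) ≡ 0ᵍ
    crossed τ τ′ σ σ′ = trans (cong ((T τ τ′ +ᵍ T σ σ′) +ᵍ_) (+ᵍ-comm (T′ σ′ σ) (T′ τ′ τ))) (straight τ τ′ σ σ′)
    cases : ∀ κ κ′ → rowSum j (κ ∷ ρ , t) j′ (κ′ ∷ ρ′ , t′) +ᵍ rowSum j′ (κ ∷ ρ , t) j (κ′ ∷ ρ′ , t′) ≡ 0ᵍ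
    cases false false = straight false false true true
    cases false true  = crossed false true true false
    cases true  false = crossed true false false true
    cases true  true  = straight true true false false

  rowSum-diagonal : ∀ j κ ρ t t′ → rowSum j (κ ∷ ρ , t) j (κ ∷ ρ , t′) ≡
    ∑ᵇ p (λ _ → if eqᶠ t t′ then fromℕᵍ (weight j) else 0ᵍ)
  rowSum-diagonal j κ ρ t t′ = trans (cong₂ _+ᵍ_ (term-diagonal j (κ xor false) ρ t t′) (term-diagonal j (κ xor true) ρ t t′)) (cases κ)
    where
    C : Bool → ℤ[i]
    C τ = corr m (seq j τ) (seq j τ) (+ toℕ t) (+ toℕ t′)
    both : ∑ᵇ p (λ _ → C false) +ᵍ ∑ᵇ p (λ _ → C true) ≡ ∑ᵇ p (λ _ → if eqᶠ t t′ then fromℕᵍ (weight j) else 0ᵍ)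
    both = trans (sym (∑-distrib-+ᵍ (2 ^ p) (λ _ → C false) (λ _ → C true))) (∑ᵇ-cong p (λ _ → complementary j t t′))
    cases : ∀ κ → ∑ᵇ p (λ _ → C (κ xor false)) +ᵍ ∑ᵇ p (λ _ → C (κ xor true)) ≡ ∑ᵇ p (λ _ → if eqᶠ t t′ then fromℕᵍ (weight j) else 0ᵍ)
    cases false = both
    cases true  = trans (+ᵍ-comm (∑ᵇ p (λ _ → C true)) (∑ᵇ p (λ _ → C false))) both

  rowSum-self : ∀ j a → rowSum j a j a ≡ fromℕᵍ (2 ^ p * weight j)
  rowSum-self j (κ ∷ ρ , t) = begin
    rowSum j (κ ∷ ρ , t) j (κ ∷ ρ , t)                            ≡⟨ rowSum-diagonal j κ ρ t t ⟩
    ∑ᵇ p (λ _ → if eqᶠ t t then fromℕᵍ (weight j) else 0ᵍ)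
      ≡⟨ ∑ᵇ-cong p (λ _ → cong (λ b → if b then fromℕᵍ (weight j) else 0ᵍ) (dec-true (t ≟ t) refl)) ⟩
    ∑ᵇ p (λ _ → fromℕᵍ (weight j))                                ≡⟨ ∑ᵇ-const p (weight j) ⟩
    fromℕᵍ (2 ^ p * weight j)                                     ∎

  -- Each index component has its own reason: complementarity separates different `t`, the Sylvester
  -- matrix different `ρ`, and anticommutation of the two sequences of one pair different `κ`.
  rowSum-orthogonal : ∀ j a b → a ≢ b → rowSum j a j b ≡ 0ᵍ
  rowSum-orthogonal j (κ ∷ ρ , t) (κ′ ∷ ρ′ , t′) a≢b with κ Boolₚ.≟ κ′ | Vecₚ.≡-dec Boolₚ._≟_ ρ ρ′
  ... | yes refl | yes refl = begin
    rowSum j (κ ∷ ρ , t) j (κ ∷ ρ , t′)                           ≡⟨ rowSum-diagonal j κ ρ t t′ ⟩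
    ∑ᵇ p (λ _ → if eqᶠ t t′ then fromℕᵍ (weight j) else 0ᵍ)
      ≡⟨ ∑-zero (2 ^ p) (λ _ → cong (λ b → if b then fromℕᵍ (weight j) else 0ᵍ)
           (dec-false (t ≟ t′) (a≢b ∘ cong (κ ∷ ρ ,_)))) ⟩
    0ᵍ ∎
  ... | yes refl | no ρ≢ρ′ = cong₂ _+ᵍ_ (zeroTerm (κ xor false)) (zeroTerm (κ xor true))
    where
    zeroTerm : ∀ τ → term j τ ρ t j τ ρ′ t′ ≡ 0ᵍ
    zeroTerm τ = term-distinct j τ ρ t j τ ρ′ t′ λ eq → ρ≢ρ′
      (trans (sym (toggle-involutive (slot j τ) ρ)) (trans (cong (toggle (slot j τ)) eq) (toggle-involutive (slot j τ) ρ′)))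
  ... | no κ≢κ′ | _ = cases κ κ′ κ≢κ′
    where
    distinct : ∀ {τ τ′} → τ ≢ τ′ → slot j τ ≢ slot j τ′
    distinct ne = ne ∘ proj₂ ∘ slot-injective
    cases : ∀ κ κ′ → κ ≢ κ′ → rowSum j (κ ∷ ρ , t) j (κ′ ∷ ρ′ , t′) ≡ 0ᵍ
    cases false false ne = ⊥-elim (ne refl)
    cases false true  ne = term-anticommute j false j true ρ t ρ′ t′ (distinct λ ())
    cases true  false ne = term-anticommute j true j false ρ t ρ′ t′ (distinct λ ())
    cases true  true  ne = ⊥-elim (ne refl)

  isCOD : IsCOD (λ j → 2 ^ p * weight j) X
  isCOD a b s t with s ≟ t
  ... | no s≢t = trans (trans (cong₂ _+ᵍ_ (ordCoeff≡ a b s t) (ordCoeff≡ a b t s)) (rowSum-cross s≢t (decode a) (decode b)))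
    (cong (λ c → if c then fromℕᵍ (2 ^ p * weight s) else 0ᵍ) (sym (Boolₚ.∧-zeroʳ (eqᶠ a b))))
  ... | yes refl with a ≟ b
  ...   | yes refl = trans (ordCoeff≡ a a s s) (rowSum-self s (decode a))
  ...   | no a≢b   = trans (ordCoeff≡ a b s s) (rowSum-orthogonal s (decode a) (decode b) (a≢b ∘ decode-injective))

-- Residues

pos-residue : ∀ k {r r′ m} .{{_ : NonZero m}} → r < m → r′ < m → + r ≡ + r′ ℤ.+ + k ℤ.* + m → r ≡ r′
pos-residue k {r} {r′} {m} r<m r′<m eq = begin
  r                 ≡⟨ sym (ℕ%.m<n⇒m%n≡m r<m) ⟩
  r % m             ≡⟨ cong (_% m) (ℤₚ.+-injective (trans eq (cong (λ z → + r′ ℤ.+ z) (sym (ℤₚ.pos-* k m))))) ⟩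
  (r′ + k * m) % m  ≡⟨ ℕ%.[m+kn]%n≡m%n r′ k m ⟩
  r′ % m            ≡⟨ ℕ%.m<n⇒m%n≡m r′<m ⟩
  r′                ∎
  where open ≡-Reasoning

%ℕ-unique : ∀ {x r m} .{{_ : NonZero m}} q → r < m → x ≡ + r ℤ.+ q ℤ.* + m → x %ℕ m ≡ r
%ℕ-unique {x} {r} {m} q r<m eq = byQuotient (q ℤ.- x /ℕ m) refl
  where
  s<m = ℤ%.n%ℕd<d x m
  division = trans (sym (ℤ%.a≡a%ℕn+[a/ℕn]*n x m)) eq
  isolate : ∀ s q′ m → s ≡ (s ℤ.+ q′ ℤ.* m) ℤ.- q′ ℤ.* m
  isolate = solve-∀
  collect : ∀ r q q′ m → (r ℤ.+ q ℤ.* m) ℤ.- q′ ℤ.* m ≡ r ℤ.+ (q ℤ.- q′) ℤ.* m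
  collect = solve-∀
  negate : ∀ r q m → r ≡ (r ℤ.+ q ℤ.* m) ℤ.+ (ℤ.- q) ℤ.* m
  negate = solve-∀
  difference : + (x %ℕ m) ≡ + r ℤ.+ (q ℤ.- x /ℕ m) ℤ.* + m
  difference = trans (isolate (+ (x %ℕ m)) (x /ℕ m) (+ m))
    (trans (cong (λ z → z ℤ.- (x /ℕ m) ℤ.* + m) division) (collect (+ r) q (x /ℕ m) (+ m)))
  byQuotient : ∀ d → q ℤ.- x /ℕ m ≡ d → x %ℕ m ≡ r
  byQuotient (+ k)    d≡ = pos-residue k s<m r<m (trans difference (cong (λ c → + r ℤ.+ c ℤ.* + m) d≡))
  -- A negative quotient is moved to the other side, which exchanges the two residues.
  byQuotient -[1+ k ] d≡ = sym (pos-residue (suc k) r<m s<m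
    (trans (negate (+ r) -[1+ k ] (+ m))
      (cong (λ z → z ℤ.+ + suc k ℤ.* + m) (sym (trans difference (cong (λ c → + r ℤ.+ c ℤ.* + m) d≡))))))

%ℕ-periodic : ∀ m .{{_ : NonZero m}} x → (x ℤ.+ + m) %ℕ m ≡ x %ℕ m
%ℕ-periodic m x = %ℕ-unique (x /ℕ m ℤ.+ 1ℤ) (ℤ%.n%ℕd<d x m)
  (trans (cong (λ z → z ℤ.+ + m) (ℤ%.a≡a%ℕn+[a/ℕn]*n x m)) (lem (+ (x %ℕ m)) (x /ℕ m) (+ m)))
  where
  lem : ∀ r q m → (r ℤ.+ q ℤ.* m) ℤ.+ m ≡ r ℤ.+ (q ℤ.+ 1ℤ) ℤ.* m
  lem = solve-∀

-- Negation gives `(m − r) + (−q − 1) m`. Positivity of `r` keeps `m − r` below `m`.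
%ℕ-neg-pos : ∀ m .{{_ : NonZero m}} x → 0 < x %ℕ m → (ℤ.- x) %ℕ m ≡ m ∸ x %ℕ m
%ℕ-neg-pos m x r>0 = %ℕ-unique (ℤ.- (x /ℕ m) ℤ.- 1ℤ) (ℕₚ.∸-monoʳ-< r>0 r≤m) (begin
  ℤ.- x                                                 ≡⟨ cong ℤ.-_ (ℤ%.a≡a%ℕn+[a/ℕn]*n x m) ⟩
  ℤ.- (+ r ℤ.+ q ℤ.* + m)                               ≡⟨ lem (+ r) q (+ m) ⟩
  (+ m ℤ.- + r) ℤ.+ (ℤ.- q ℤ.- 1ℤ) ℤ.* + m              ≡⟨ cong (λ z → z ℤ.+ (ℤ.- q ℤ.- 1ℤ) ℤ.* + m) (trans (ℤₚ.m-n≡m⊖n m r) (ℤₚ.⊖-≥ r≤m)) ⟩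
  + (m ∸ r) ℤ.+ (ℤ.- q ℤ.- 1ℤ) ℤ.* + m                  ∎)
  where
  open ≡-Reasoning
  r = x %ℕ m
  q = x /ℕ m
  r≤m = ℕₚ.<⇒≤ (ℤ%.n%ℕd<d x m)
  lem : ∀ r q m → ℤ.- (r ℤ.+ q ℤ.* m) ≡ (m ℤ.- r) ℤ.+ (ℤ.- q ℤ.- 1ℤ) ℤ.* m
  lem = solve-∀

-- Periodic autocorrelation of a delayed sequence

delay : ℕ → (ℕ → ℤ[i]) → ℕ → ℤ[i]
delay zero    a x       = a x
delay (suc o) a zero    = 0ᵍ
delay (suc o) a (suc x) = delay o a x

delay-before : ∀ o a x → x < o → delay o a x ≡ 0ᵍ
delay-before (suc o) a zero    _         = refl
delay-before (suc o) a (suc x) (s≤s x<o) = delay-before o a x x<o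

delay-after : ∀ o a x → delay o a (o + x) ≡ a x
delay-after zero    a x = refl
delay-after (suc o) a x = delay-after o a x

delay-shift : ∀ d o a x → delay (d + o) a (d + x) ≡ delay o a x
delay-shift zero    o a x = refl
delay-shift (suc d) o a x = delay-shift d o a x

delay-vanishes : ∀ o {k a} → (∀ x → k ≤ x → a x ≡ 0ᵍ) → ∀ x → o + k ≤ x → delay o a x ≡ 0ᵍ
delay-vanishes zero    a≗0 x       k≤x       = a≗0 x k≤x
delay-vanishes (suc o) a≗0 (suc x) (s≤s le)  = delay-vanishes o a≗0 x le

∑<-delay : ∀ o n a (h : ℕ → ℤ[i]) → ∑< (o + n) (λ x → delay o a x *ᵍ h x) ≡ ∑< n (λ x → a x *ᵍ h (o + x))
∑<-delay zero    n a h = refl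
∑<-delay (suc o) n a h = trans (+ᵍ-identityˡ _) (∑<-delay o n a (h ∘ suc))

acf : (ℕ → ℤ[i]) → ℕ → ℕ → ℤ[i]
acf a n j = ∑< n (λ x → a (x + j) *ᵍ conj (a x))

acf-delay : ∀ o n a j → acf (delay o a) (o + n) j ≡ acf a n j
acf-delay zero    n a j = refl
acf-delay (suc o) n a j = trans (cong₂ _+ᵍ_ (*ᵍ-zeroʳ (delay (suc o) a j)) refl)
  (trans (+ᵍ-identityˡ _) (acf-delay o n a j))

acf-pad : ∀ k n {a} → (∀ x → k ≤ x → a x ≡ 0ᵍ) → ∀ j → acf a (k + n) j ≡ acf a k j
acf-pad k n {a} a≗0 j = ∑<-pad k n (λ x k≤x → trans (cong (λ z → a (x + j) *ᵍ conj z) (a≗0 x k≤x)) (*ᵍ-zeroʳ (a (x + j))))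

acf-placed : ∀ {o k m a} → o + k ≤ m → (∀ x → k ≤ x → a x ≡ 0ᵍ) → ∀ j → acf (delay o a) m j ≡ acf a k j
acf-placed {o} {k} {m} {a} o+k≤m a≗0 j = begin
  acf (delay o a) m j                       ≡⟨ cong (λ n → acf (delay o a) n j) (sym (ℕₚ.m+[n∸m]≡n o+k≤m)) ⟩
  acf (delay o a) (o + k + (m ∸ (o + k))) j ≡⟨ cong (λ n → acf (delay o a) n j) (ℕₚ.+-assoc o k _) ⟩
  acf (delay o a) (o + (k + (m ∸ (o + k)))) j ≡⟨ acf-delay o _ a j ⟩
  acf a (k + (m ∸ (o + k))) j               ≡⟨ acf-pad k _ a≗0 j ⟩
  acf a k j                                 ∎
  where open ≡-Reasoning

wrap : (m : ℕ) .{{_ : NonZero m}} → (ℕ → ℤ[i]) → ℤ → ℤ[i]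
wrap m g x = g (x %ℕ m)

wrap-periodic : ∀ m .{{_ : NonZero m}} g → Periodic m (wrap m g)
wrap-periodic m g x = cong g (%ℕ-periodic m x)

-- Since `g` vanishes from `m` on, at most one of the two copies is nonzero at `x`. A sum in place
-- of a case distinction lets the correlation be split linearly.
fold-residue : ∀ m .{{_ : NonZero m}} {g} → (∀ x → m ≤ x → g x ≡ 0ᵍ) → ∀ x → x < m + m → g (x % m) ≡ g x +ᵍ delay m g x
fold-residue m {g} g≗0 x x<m+m with x <? m
... | yes x<m = begin
  g (x % m)           ≡⟨ cong g (ℕ%.m<n⇒m%n≡m x<m) ⟩
  g x                 ≡⟨ sym (+ᵍ-identityʳ (g x)) ⟩
  g x +ᵍ 0ᵍ           ≡⟨ cong (g x +ᵍ_) (sym (delay-before m g x x<m)) ⟩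
  g x +ᵍ delay m g x  ∎
  where open ≡-Reasoning
... | no x≮m = begin
  g (x % m)              ≡⟨ cong (λ z → g (z % m)) x≡ ⟩
  g ((m + y) % m)        ≡⟨ cong g (trans (cong (_% m) (ℕₚ.+-comm m y)) (trans (ℕ%.[m+n]%n≡m%n y m) (ℕ%.m<n⇒m%n≡m y<m))) ⟩
  g y                    ≡⟨ sym (delay-after m g y) ⟩
  delay m g (m + y)      ≡⟨ cong (delay m g) (sym x≡) ⟩
  delay m g x            ≡⟨ sym (+ᵍ-identityˡ (delay m g x)) ⟩
  0ᵍ +ᵍ delay m g x      ≡⟨ cong (_+ᵍ delay m g x) (sym (g≗0 x m≤x)) ⟩
  g x +ᵍ delay m g x     ∎
  where
  open ≡-Reasoning
  m≤x = ℕₚ.≮⇒≥ x≮m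
  y = x ∸ m
  x≡ : x ≡ m + y
  x≡ = sym (ℕₚ.m+[n∸m]≡n m≤x)
  y<m : y < m
  y<m = ℕₚ.+-cancelˡ-< m y m (subst (_< m + m) x≡ x<m+m)

corr-wrap-shift : ∀ m .{{_ : NonZero m}} g d t → corr m (wrap m g) (wrap m g) (+ t) (+ (d + t))
  ≡ ∑< m (λ x → g ((x + d) % m) *ᵍ conj (g (x % m)))
corr-wrap-shift m g d t = trans (∑<-cong m (λ u _ → cong (λ z → wrap m g z *ᵍ conj (wrap m g (+ u ℤ.- + (d + t)))) (lem (+ u) (+ d) (+ t))))
  (∑ᶻ-shift m {h} per (ℤ.- + (d + t)))
  where
  h : ℤ → ℤ[i]
  h x = wrap m g (x ℤ.+ + d) *ᵍ conj (wrap m g x)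
  lem : ∀ u d t → u ℤ.- t ≡ (u ℤ.- (d ℤ.+ t)) ℤ.+ d
  lem = solve-∀
  swap : ∀ x m d → (x ℤ.+ m) ℤ.+ d ≡ (x ℤ.+ d) ℤ.+ m
  swap = solve-∀
  per : Periodic m h
  per x = cong₂ (λ y z → y *ᵍ conj z)
    (trans (cong (wrap m g) (swap x (+ m) (+ d))) (wrap-periodic m g (x ℤ.+ + d))) (wrap-periodic m g x)

corr-wrap-self : ∀ m .{{_ : NonZero m}} g t → corr m (wrap m g) (wrap m g) (+ t) (+ t) ≡ acf g m 0
corr-wrap-self m g t = trans (corr-wrap-shift m g 0 t) (∑<-cong m λ x x<m →
  cong₂ (λ y z → g y *ᵍ conj (g z)) (trans (cong (_% m) (ℕₚ.+-identityʳ x)) (trans (ℕ%.m<n⇒m%n≡m x<m) (sym (ℕₚ.+-identityʳ x)))) (ℕ%.m<n⇒m%n≡m x<m))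

-- On a cycle of length `m`, a sequence and its shift by `d` overlap in two pieces: directly at
-- distance `d`, and around the end at distance `m − d` with the roles of the factors exchanged,
-- which accounts for the conjugate.
corr-wrap-acf : ∀ m .{{_ : NonZero m}} {g} → (∀ x → m ≤ x → g x ≡ 0ᵍ) → ∀ d d′ → d + d′ ≡ m → ∀ t →
  corr m (wrap m g) (wrap m g) (+ t) (+ (d + t)) ≡ acf g m d +ᵍ conj (acf g m d′)
corr-wrap-acf m {g} g≗0 d d′ refl t = begin
  corr m (wrap m g) (wrap m g) (+ t) (+ (d + t))
    ≡⟨ corr-wrap-shift m g d t ⟩
  ∑< m (λ x → g ((x + d) % m) *ᵍ conj (g (x % m)))
    ≡⟨ ∑<-cong m split ⟩
  ∑< m (λ x → (g (x + d) *ᵍ conj (g x)) +ᵍ (delay d′ g x *ᵍ conj (g x)))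
    ≡⟨ ∑-distrib-+ᵍ m (λ x → g (toℕ x + d) *ᵍ conj (g (toℕ x))) (λ x → delay d′ g (toℕ x) *ᵍ conj (g (toℕ x))) ⟩
  acf g m d +ᵍ ∑< m (λ x → delay d′ g x *ᵍ conj (g x))
    ≡⟨ cong (acf g m d +ᵍ_) tail≡ ⟩
  acf g m d +ᵍ conj (acf g m d′) ∎
  where
  open ≡-Reasoning
  split : ∀ x → x < m → g ((x + d) % m) *ᵍ conj (g (x % m)) ≡ (g (x + d) *ᵍ conj (g x)) +ᵍ (delay d′ g x *ᵍ conj (g x))
  split x x<m = begin
    g ((x + d) % m) *ᵍ conj (g (x % m))
      ≡⟨ cong₂ (λ y z → y *ᵍ conj (g z)) (fold-residue m g≗0 (x + d) (ℕₚ.+-mono-<-≤ x<m (ℕₚ.m≤m+n d d′))) (ℕ%.m<n⇒m%n≡m x<m) ⟩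
    (g (x + d) +ᵍ delay m g (x + d)) *ᵍ conj (g x)
      ≡⟨ cong (λ z → (g (x + d) +ᵍ z) *ᵍ conj (g x)) (trans (cong (delay m g) (ℕₚ.+-comm x d)) (delay-shift d d′ g x)) ⟩
    (g (x + d) +ᵍ delay d′ g x) *ᵍ conj (g x)
      ≡⟨ *ᵍ-distribʳ (conj (g x)) (g (x + d)) (delay d′ g x) ⟩
    (g (x + d) *ᵍ conj (g x)) +ᵍ (delay d′ g x *ᵍ conj (g x)) ∎
  beyond : ∀ x → d ≤ x → g x *ᵍ conj (g (d′ + x)) ≡ 0ᵍ
  beyond x d≤x = trans (cong (λ z → g x *ᵍ conj z) (g≗0 (d′ + x) (subst (_≤ d′ + x) (ℕₚ.+-comm d′ d) (ℕₚ.+-monoʳ-≤ d′ d≤x))))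
    (*ᵍ-zeroʳ (g x))
  tail≡ : ∑< m (λ x → delay d′ g x *ᵍ conj (g x)) ≡ conj (acf g m d′)
  tail≡ = begin
    ∑< (d + d′) (λ x → delay d′ g x *ᵍ conj (g x))
      ≡⟨ cong (λ n → ∑< n (λ x → delay d′ g x *ᵍ conj (g x))) (ℕₚ.+-comm d d′) ⟩
    ∑< (d′ + d) (λ x → delay d′ g x *ᵍ conj (g x))  ≡⟨ ∑<-delay d′ d g (conj ∘ g) ⟩
    ∑< d (λ x → g x *ᵍ conj (g (d′ + x)))           ≡⟨ sym (∑<-pad d d′ beyond) ⟩
    ∑< m (λ x → g x *ᵍ conj (g (d′ + x)))
      ≡⟨ ∑<-cong m (λ x _ → trans (*ᵍ-conj-swap (g x) (g (d′ + x))) (cong (λ z → conj (g z *ᵍ conj (g x))) (ℕₚ.+-comm d′ x))) ⟩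
    ∑< m (λ x → conj (g (x + d′) *ᵍ conj (g x)))    ≡⟨ ∑-conj m (λ x → g (toℕ x + d′) *ᵍ conj (g (toℕ x))) ⟩
    conj (acf g m d′) ∎

-- The common form of real and complex Golay pairs. Shift 0, about which the Golay condition is
-- silent, is covered by `energy`.
record Complementary (k : ℕ) : Set where
  field
    pair      : Bool → ℕ → ℤ[i]
    vanishing : ∀ τ x → k ≤ x → pair τ x ≡ 0ᵍ
    unital    : ∀ τ x → x < k → ∃ λ w → pair τ x ≡ unitVal w
    energy    : acf (pair false) k 0 +ᵍ acf (pair true) k 0 ≡ fromℕᵍ (k + k)
    acf-sum   : ∀ j → 0 < j → acf (pair false) k j +ᵍ acf (pair true) k j ≡ 0ᵍ

module Placed {k} (P : Complementary k) (o m : ℕ) .{{_ : NonZero m}} (o+k≤m : o + k ≤ m) where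
  open Complementary P
  open ≡-Reasoning

  placed : Bool → ℤ → ℤ[i]
  placed τ = wrap m (delay o (pair τ))

  placed-periodic : ∀ τ → Periodic m (placed τ)
  placed-periodic τ = wrap-periodic m (delay o (pair τ))

  private
    D : Bool → ℕ → ℤ[i]
    D τ = delay o (pair τ)

    beyond : ∀ τ x → m ≤ x → D τ x ≡ 0ᵍ
    beyond τ x m≤x = delay-vanishes o (vanishing τ) x (ℕₚ.≤-trans o+k≤m m≤x)

    D-acf : ∀ τ j → acf (D τ) m j ≡ acf (pair τ) k j
    D-acf τ = acf-placed o+k≤m (vanishing τ)

    C : ℤ → ℤ → ℤ[i]
    C t t′ = corr m (placed false) (placed false) t t′ +ᵍ corr m (placed true) (placed true) t t′

    C-self : ∀ t → C (+ t) (+ t) ≡ fromℕᵍ (k + k)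
    C-self t = trans (cong₂ _+ᵍ_ (each false) (each true)) energy
      where
      each : ∀ τ → corr m (placed τ) (placed τ) (+ t) (+ t) ≡ acf (pair τ) k 0
      each τ = trans (corr-wrap-self m (D τ) t) (D-acf τ 0)

    -- Both `d` and `m − d` are positive, so the aperiodic condition applies to both pieces of the
    -- overlap.
    C-less : ∀ {t t′} → t < t′ → t′ < m → C (+ t) (+ t′) ≡ 0ᵍ
    C-less {t} {t′} t<t′ t′<m = begin
      C (+ t) (+ t′)                          ≡⟨ cong (λ s → C (+ t) (+ s)) (sym (ℕₚ.m∸n+n≡m (ℕₚ.<⇒≤ t<t′))) ⟩
      C (+ t) (+ (d + t))                     ≡⟨ cong₂ _+ᵍ_ (each false) (each true) ⟩
      (N false d +ᵍ conj (N false d′)) +ᵍ (N true d +ᵍ conj (N true d′))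
        ≡⟨ +ᵍ-interchange (N false d) (conj (N false d′)) (N true d) (conj (N true d′)) ⟩
      (N false d +ᵍ N true d) +ᵍ (conj (N false d′) +ᵍ conj (N true d′))
        ≡⟨ cong ((N false d +ᵍ N true d) +ᵍ_) (sym (conj-+ᵍ (N false d′) (N true d′))) ⟩
      (N false d +ᵍ N true d) +ᵍ conj (N false d′ +ᵍ N true d′)
        ≡⟨ cong₂ (λ y z → y +ᵍ conj z) (acf-sum d (ℕₚ.m<n⇒0<n∸m t<t′)) (acf-sum d′ (ℕₚ.m<n⇒0<n∸m d<m)) ⟩
      0ᵍ ∎
      where
      d = t′ ∸ t
      d′ = m ∸ d
      d<m : d < m
      d<m = ℕₚ.≤-<-trans (ℕₚ.m∸n≤m t′ t) t′<m
      N : Bool → ℕ → ℤ[i]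
      N τ = acf (pair τ) k
      each : ∀ τ → corr m (placed τ) (placed τ) (+ t) (+ (d + t)) ≡ N τ d +ᵍ conj (N τ d′)
      each τ = trans (corr-wrap-acf m (beyond τ) d d′ (ℕₚ.m+[n∸m]≡n (ℕₚ.<⇒≤ d<m)) t)
        (cong₂ (λ y z → y +ᵍ conj z) (D-acf τ d) (D-acf τ d′))

    C-conj : ∀ t t′ → C t t′ ≡ conj (C t′ t)
    C-conj t t′ = trans (cong₂ _+ᵍ_ (corr-conj m (placed false) (placed false) t t′) (corr-conj m (placed true) (placed true) t t′))
      (sym (conj-+ᵍ (corr m (placed false) (placed false) t′ t) (corr m (placed true) (placed true) t′ t)))

  placed-complementary : ∀ (t t′ : Fin m) →
    corr m (placed false) (placed false) (+ toℕ t) (+ toℕ t′) +ᵍ corr m (placed true) (placed true) (+ toℕ t) (+ toℕ t′)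
      ≡ (if eqᶠ t t′ then fromℕᵍ (k + k) else 0ᵍ)
  placed-complementary t t′ with t ≟ t′
  ... | yes refl = C-self (toℕ t)
  ... | no t≢t′ with ℕₚ.<-cmp (toℕ t) (toℕ t′)
  ...   | tri< lt _ _ = C-less lt (Finₚ.toℕ<n t′)
  ...   | tri≈ _ eq _ = ⊥-elim (t≢t′ (Finₚ.toℕ-injective eq))
  ...   | tri> _ _ gt = trans (C-conj (+ toℕ t) (+ toℕ t′)) (cong conj (C-less gt (Finₚ.toℕ<n t)))

  placed-cases : ∀ τ x → placed τ x ≡ 0ᵍ ⊎ ∃ λ y → y < k × x %ℕ m ≡ o + y × ∃ λ w → placed τ x ≡ unitVal w
  placed-cases τ x with x %ℕ m <? o
  ... | yes r<o = inj₁ (delay-before o (pair τ) _ r<o)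
  ... | no r≮o with x %ℕ m ∸ o <? k
  ...   | yes y<k = inj₂ (x %ℕ m ∸ o , y<k , r≡ , proj₁ (unital τ _ y<k) ,
            trans (cong (D τ) r≡) (trans (delay-after o (pair τ) _) (proj₂ (unital τ _ y<k))))
    where
    r≡ : x %ℕ m ≡ o + (x %ℕ m ∸ o)
    r≡ = sym (ℕₚ.m+[n∸m]≡n (ℕₚ.≮⇒≥ r≮o))
  ...   | no y≮k = inj₁ (trans (cong (D τ) (sym (ℕₚ.m+[n∸m]≡n (ℕₚ.≮⇒≥ r≮o))))
            (trans (delay-after o (pair τ) _) (vanishing τ _ (ℕₚ.≮⇒≥ y≮k))))

-- Golay pairs as complementary pairs

unit-norm : ∀ {z} w → z ≡ unitVal w → z *ᵍ conj z ≡ fromℕᵍ 1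
unit-norm one  refl = refl
unit-norm i    refl = refl
unit-norm mone refl = refl
unit-norm mi   refl = refl

∑<-ones : ∀ k → ∑< k (λ _ → fromℕᵍ 1) ≡ fromℕᵍ k
∑<-ones zero    = refl
∑<-ones (suc k) = cong (fromℕᵍ 1 +ᵍ_) (∑<-ones k)

module _ {A : Set} (val : A → ℤ[i]) (isUnitVal : ∀ x → ∃ λ w → val x ≡ unitVal w) where

  ext-vanishing : ∀ {k} (a : Vec A k) x → k ≤ x → ext val a x ≡ 0ᵍ
  ext-vanishing {k} a x k≤x with x <? k
  ... | yes x<k = ⊥-elim (ℕₚ.<⇒≱ x<k k≤x)
  ... | no  _   = refl

  ext-unital : ∀ {k} (a : Vec A k) x → x < k → ∃ λ w → ext val a x ≡ unitVal w
  ext-unital {k} a x x<k with x <? k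
  ... | yes x<k′ = isUnitVal (lookup a (fromℕ< x<k′))
  ... | no  x≮k  = ⊥-elim (x≮k x<k)

  ext-energy : ∀ {k} (a : Vec A k) → acf (ext val a) k 0 ≡ fromℕᵍ k
  ext-energy {k} a = trans (∑<-cong k λ x x<k →
    trans (cong (λ y → ext val a y *ᵍ conj (ext val a x)) (ℕₚ.+-identityʳ x))
      (unit-norm (proj₁ (ext-unital a x x<k)) (proj₂ (ext-unital a x x<k)))) (∑<-ones k)

  fromVectors : ∀ {k} (a b : Vec A k) → (∀ j → 0 < j → autocorr val a j +ᵍ autocorr val b j ≡ 0ᵍ) → Complementary k
  fromVectors a b golay = record
    { pair      = λ τ → ext val (if τ then b else a)
    ; vanishing = λ τ → ext-vanishing (if τ then b else a)
    ; unital    = λ τ → ext-unital (if τ then b else a)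
    ; energy    = cong₂ _+ᵍ_ (ext-energy a) (ext-energy b)
    ; acf-sum   = golay
    }

golayPair : ∀ {r} → GolayNumber r → Complementary r
golayPair (_ , a , b , golay) = fromVectors signVal (λ { plus → one , refl ; minus → mone , refl }) a b golay

complexGolayPair : ∀ {k} → ComplexGolayNumber k → Complementary k
complexGolayPair (_ , a , b , golay) = fromVectors unitVal (λ w → w , refl) a b golay

-- The pair for `x`, placed at residue 0 as a block of length 1.
complexGolayNumber-1 : ComplexGolayNumber 1
complexGolayNumber-1 = z<s , one ∷ [] , one ∷ [] , λ { (suc j) _ → refl }

-- Layout of the blocks

offset : ∀ {L} → (Fin L → ℕ) → Fin L → ℕ
offset k zero    = 0
offset k (suc j) = k zero + offset (k ∘ suc) j

offset+length≤sum : ∀ {L} (k : Fin L → ℕ) j → offset k j + k j ≤ sumℕ L k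
offset+length≤sum k zero    = ℕₚ.m≤m+n (k zero) _
offset+length≤sum {suc L} k (suc j) = subst (_≤ sumℕ (suc L) k) (sym (ℕₚ.+-assoc (k zero) (offset (k ∘ suc) j) (k (suc j))))
  (ℕₚ.+-monoʳ-≤ (k zero) (offset+length≤sum (k ∘ suc) j))

-- The block containing a position, shifted by one; zero stands for positions behind all blocks.
block : ∀ L → (Fin L → ℕ) → ℕ → Fin (suc L)
block zero    k x = zero
block (suc L) k x = if does (x <? k zero) then suc zero else punchIn (suc zero) (block L (k ∘ suc) (x ∸ k zero))

block-inside : ∀ {L} (k : Fin L → ℕ) j y → y < k j → block L k (offset k j + y) ≡ suc j
block-inside k zero y y<k rewrite dec-true (y <? k zero) y<k = refl
block-inside k (suc j) y y<k
  rewrite ℕₚ.+-assoc (k zero) (offset (k ∘ suc) j) y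
        | dec-false (k zero + (offset (k ∘ suc) j + y) <? k zero) (ℕₚ.m+n≮m (k zero) _)
        | ℕₚ.m+n∸m≡n (k zero) (offset (k ∘ suc) j + y)
        | block-inside (k ∘ suc) j y y<k = refl

block-behind : ∀ {L} (k : Fin L → ℕ) x → sumℕ L k ≤ x → block L k x ≡ zero
block-behind {zero}  k x _  = refl
block-behind {suc L} k x le
  rewrite dec-false (x <? k zero) (ℕₚ.≤⇒≯ (ℕₚ.m+n≤o⇒m≤o (k zero) le))
        | block-behind (k ∘ suc) (x ∸ k zero)
            (subst (_≤ x ∸ k zero) (ℕₚ.m+n∸m≡n (k zero) _) (ℕₚ.∸-monoˡ-≤ (k zero) le)) = refl

-- The argument is the distance from 0 on the cycle: 0 belongs to `x`, the distances 1 to `K` belong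
-- to the complex pairs, and all larger ones to `y`.
variable-at : ∀ L → (Fin L → ℕ) → ℕ → Fin (2 + L)
variable-at L k zero    = zero
variable-at L k (suc x) = suc (block L k x)

-- The residues split as `1 + K + r + K`: the position of `x`, the blocks of the `C`, the block of
-- `y`, and the mirror images of the blocks, which carry the `D*`.
module Layout (r L m : ℕ) (k : Fin L → ℕ) .{{_ : NonZero m}} (m≡ : m ≡ suc (sumℕ L k) + (sumℕ L k + r))
  (R : Complementary r) (Z : ∀ j → Complementary (k j)) where

  K : ℕ
  K = sumℕ L k

  1+K≤m : suc K ≤ m
  1+K≤m = subst (suc K ≤_) (sym m≡) (ℕₚ.m≤m+n (suc K) _)

  res res⁻ : ℤ → ℕ
  res x = x %ℕ m
  res⁻ x = (ℤ.- x) %ℕ m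

  near⇒far : ∀ x → 0 < res x → res x ≤ K → K < res⁻ x
  near⇒far x r>0 r≤K = subst (K <_) (sym (%ℕ-neg-pos m x r>0)) (ℕₚ.m+n≤o⇒m≤o∸n (suc K) (begin
    suc K + res x    ≤⟨ ℕₚ.+-monoʳ-≤ (suc K) r≤K ⟩
    suc K + K        ≤⟨ ℕₚ.+-monoʳ-≤ (suc K) (ℕₚ.m≤m+n K r) ⟩
    suc K + (K + r)  ≡⟨ sym m≡ ⟩
    m                ∎))
    where open ℕₚ.≤-Reasoning

  -- The residue `K + 1 + y` reflects to `K + r − y`, which exceeds `K` because `y < r`.
  middle⇒middle : ∀ x y → y < r → res x ≡ suc K + y → K < res⁻ x
  middle⇒middle x y y<r eq = subst (K <_) (sym (%ℕ-neg-pos m x (subst (0 <_) (sym eq) z<s))) (ℕₚ.m+n≤o⇒m≤o∸n (suc K) (begin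
    suc K + res x        ≡⟨ cong (_+_ (suc K)) eq ⟩
    suc K + (suc K + y)  ≡⟨ lem K y ⟩
    suc K + (K + suc y)  ≤⟨ ℕₚ.+-monoʳ-≤ (suc K) (ℕₚ.+-monoʳ-≤ K y<r) ⟩
    suc K + (K + r)      ≡⟨ sym m≡ ⟩
    m                    ∎))
    where
    open ℕₚ.≤-Reasoning
    lem : ∀ K y → suc K + (suc K + y) ≡ suc K + (K + suc y)
    lem = ℕSolver.solve-∀

  -- Folding x onto -x makes the regions symmetric, as starring a sequence reflects it.
  region : ℤ → Fin (2 + L)
  region x = variable-at L k (res x ⊓ res⁻ x)

  region-neg : ∀ x → region (ℤ.- x) ≡ region x
  region-neg x = cong (variable-at L k) (trans (cong (λ y → res⁻ x ⊓ (y %ℕ m)) (ℤₚ.neg-involutive x)) (ℕₚ.⊓-comm (res⁻ x) (res x)))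

  o+k≤m : ∀ j → suc (offset k j) + k j ≤ m
  o+k≤m j = ℕₚ.≤-trans (s≤s (offset+length≤sum k j)) 1+K≤m

  module PX = Placed (complexGolayPair complexGolayNumber-1) 0 m (ℕₚ.≤-trans (s≤s z≤n) 1+K≤m)
  module PY = Placed R (suc K) m (subst (suc K + r ≤_) (sym m≡) (ℕₚ.+-monoʳ-≤ (suc K) (ℕₚ.m≤n+m r K)))
  module PZ (j : Fin L) = Placed (Z j) (suc (offset k j)) m (o+k≤m j)

  seq : Fin (2 + L) → Bool → ℤ → ℤ[i]
  seq zero          τ = PX.placed τ
  seq (suc zero)    τ = PY.placed τ
  seq (suc (suc j)) τ = λ x → PZ.placed j false x +ᵍ sgn τ (star (PZ.placed j true) x)

  periodic : ∀ j τ → Periodic m (seq j τ)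
  periodic zero          τ = PX.placed-periodic τ
  periodic (suc zero)    τ = PY.placed-periodic τ
  periodic (suc (suc j)) τ x = cong₂ (λ y z → y +ᵍ sgn τ z)
    (PZ.placed-periodic j false x) (periodic-star {m} (PZ.placed-periodic j true) x)

  block-near : ∀ j x y → y < k j → res x ≡ suc (offset k j) + y → res x ≤ K
  block-near j x y y<k eq = subst (_≤ K) (sym eq)
    (ℕₚ.≤-trans (ℕₚ.+-monoʳ-< (offset k j) y<k) (offset+length≤sum k j))

  region-block : ∀ j x y → y < k j → res x ≡ suc (offset k j) + y → region x ≡ suc (suc j)
  region-block j x y y<k eq = trans (cong (variable-at L k) (trans (ℕₚ.m≤n⇒m⊓n≡m (ℕₚ.≤-trans r≤K (ℕₚ.<⇒≤ (near⇒far x (subst (0 <_) (sym eq) z<s) r≤K)))) eq))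
    (cong suc (block-inside k j y y<k))
    where r≤K = block-near j x y y<k eq

  region-middle : ∀ x y → y < r → res x ≡ suc K + y → region x ≡ suc zero
  region-middle x y y<r eq = far (res x ⊓ res⁻ x) (ℕₚ.⊓-glb (subst (K <_) (sym eq) (s≤s (ℕₚ.m≤m+n K y))) (middle⇒middle x y y<r eq))
    where
    far : ∀ z → K < z → variable-at L k z ≡ suc zero
    far (suc z) (s≤s K≤z) = cong suc (block-behind k z K≤z)

  fits : ∀ j τ x → Fits (region x) j (seq j τ x)
  fits zero τ x with PX.placed-cases τ x
  ... | inj₁ eq = vanishes eq
  ... | inj₂ (zero , _ , eq , w , val) = isUnit (cong (λ z → variable-at L k (z ⊓ res⁻ x)) eq) w val
  ... | inj₂ (suc _ , s≤s () , _)
  fits (suc zero) τ x with PY.placed-cases τ x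
  ... | inj₁ eq = vanishes eq
  ... | inj₂ (y , y<r , eq , w , val) = isUnit (region-middle x y y<r eq) w val
  fits (suc (suc j)) τ x with PZ.placed-cases j false x | PZ.placed-cases j true (ℤ.- x)
  ... | inj₁ eq | inj₁ eq′ = vanishes (trans (cong₂ (λ y z → y +ᵍ sgn τ (conj z)) eq eq′) (trans (+ᵍ-identityˡ (sgn τ 0ᵍ)) (sgn-0ᵍ τ)))
  ... | inj₂ (y , y<k , eq , w , val) | inj₁ eq′ =
    isUnit (region-block j x y y<k eq) w
      (trans (cong₂ (λ y z → y +ᵍ sgn τ (conj z)) val eq′) (trans (cong (unitVal w +ᵍ_) (sgn-0ᵍ τ)) (+ᵍ-identityʳ (unitVal w))))
  ... | inj₁ eq | inj₂ (y , y<k , eq′ , w , val) =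
    subst (Fits (region x) (suc (suc j))) (sym (trans (cong (_+ᵍ sgn τ (star (PZ.placed j true) x)) eq) (+ᵍ-identityˡ _)))
      (fits-sgn τ (fits-conj (isUnit (trans (sym (region-neg x)) (region-block j (ℤ.- x) y y<k eq′)) w val)))
  -- `C` and `D*` cannot both be nonzero at `x`: then `x` and `−x` would both have residues between
  -- 1 and `K`.
  ... | inj₂ (y , y<k , eq , _) | inj₂ (y′ , y′<k , eq′ , _) =
    ⊥-elim (ℕₚ.<⇒≱ (near⇒far x (subst (0 <_) (sym eq) z<s) (block-near j x y y<k eq)) (block-near j (ℤ.- x) y′ y′<k eq′))

  -- A pair of length `k` has energy `2k`. For the complex pairs this doubles, because `C + D*` and
  -- `C − D*` each contain both sequences.
  weight : Fin (2 + L) → ℕ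
  weight zero          = 1 + 1
  weight (suc zero)    = r + r
  weight (suc (suc j)) = (k j + k j) + (k j + k j)

  complementary : ∀ j (t t′ : Fin m) →
    corr m (seq j false) (seq j false) (+ toℕ t) (+ toℕ t′) +ᵍ corr m (seq j true) (seq j true) (+ toℕ t) (+ toℕ t′)
      ≡ (if eqᶠ t t′ then fromℕᵍ (weight j) else 0ᵍ)
  complementary zero          t t′ = PX.placed-complementary t t′
  complementary (suc zero)    t t′ = PY.placed-complementary t t′
  complementary (suc (suc j)) t t′ = begin
    corr m (seq (suc (suc j)) false) (seq (suc (suc j)) false) s s′ +ᵍ corr m (seq (suc (suc j)) true) (seq (suc (suc j)) true) s s′
      ≡⟨ sym (∑-distrib-+ᵍ m _ _) ⟩
    ∑ᶻ m (λ u → (seq (suc (suc j)) false (u ℤ.- s) *ᵍ conj (seq (suc (suc j)) false (u ℤ.- s′))) +ᵍ (seq (suc (suc j)) true (u ℤ.- s) *ᵍ conj (seq (suc (suc j)) true (u ℤ.- s′))))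
      ≡⟨ ∑<-cong m (λ u _ → parallelogram (e (+ u ℤ.- s)) (star f (+ u ℤ.- s)) (e (+ u ℤ.- s′)) (star f (+ u ℤ.- s′))) ⟩
    ∑ᶻ m (λ u → E u +ᵍ E u)                      ≡⟨ ∑-distrib-+ᵍ m (λ u → E (+ toℕ u)) (λ u → E (+ toℕ u)) ⟩
    ∑ᶻ m E +ᵍ ∑ᶻ m E                             ≡⟨ cong₂ _+ᵍ_ half half ⟩
    H (k j + k j) +ᵍ H (k j + k j)               ≡⟨ double (eqᶠ t t′) (k j + k j) ⟩
    H ((k j + k j) + (k j + k j))                ∎
    where
    open ≡-Reasoning
    s s′ : ℤ
    s = + toℕ t
    s′ = + toℕ t′
    e f : ℤ → ℤ[i]
    e = PZ.placed j false
    f = PZ.placed j true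
    E : ℤ → ℤ[i]
    E u = (e (u ℤ.- s) *ᵍ conj (e (u ℤ.- s′))) +ᵍ (star f (u ℤ.- s) *ᵍ conj (star f (u ℤ.- s′)))
    H : ℕ → ℤ[i]
    H w = if eqᶠ t t′ then fromℕᵍ w else 0ᵍ
    double : ∀ b w → (if b then fromℕᵍ w else 0ᵍ) +ᵍ (if b then fromℕᵍ w else 0ᵍ) ≡ (if b then fromℕᵍ (w + w) else 0ᵍ)
    double true  w = refl
    double false w = refl
    half : ∑ᶻ m E ≡ H (k j + k j)
    half = begin
      ∑ᶻ m E                                          ≡⟨ ∑-distrib-+ᵍ m _ _ ⟩
      corr m e e s s′ +ᵍ corr m (star f) (star f) s s′ ≡⟨ cong (corr m e e s s′ +ᵍ_) (corr-star-star m (PZ.placed-periodic j true) s s′) ⟩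
      corr m e e s s′ +ᵍ corr m f f s s′              ≡⟨ PZ.placed-complementary j t t′ ⟩
      H (k j + k j)                                   ∎

  sequences : Sequences (2 + L) m weight
  sequences = record
    { seq           = seq
    ; periodic      = periodic
    ; complementary = complementary
    ; region        = region
    ; region-neg    = region-neg
    ; fits          = fits
    }

-- Bits for the sequences and the count of parameters

module Slots {v p : ℕ} (v*2≤p : v * 2 ≤ p) where

  bit : Bool → Fin 2
  bit false = zero
  bit true  = suc zero

  bit-injective : ∀ {τ τ′} → bit τ ≡ bit τ′ → τ ≡ τ′
  bit-injective {false} {false} _ = refl
  bit-injective {true}  {true}  _ = refl

  slot : Fin v → Bool → Fin p
  slot j τ = inject≤ (combine j (bit τ)) v*2≤p

  slot-injective : ∀ {j τ j′ τ′} → slot j τ ≡ slot j′ τ′ → j ≡ j′ × τ ≡ τ′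
  slot-injective {j} {τ} {j′} {τ′} eq = proj₁ both , bit-injective (proj₂ both)
    where both = Finₚ.combine-injective j (bit τ) j′ (bit τ′) (Finₚ.inject≤-injective v*2≤p v*2≤p _ _ eq)

cod-from-golay : ∀ p r L (k : Fin L → ℕ) → (2 + L) * 2 ≤ p → GolayNumber r → (∀ j → ComplexGolayNumber (k j)) →
  COD (2 ^ suc p * (2 * sumℕ L k + r + 1)) (codWeights (suc p) r L k)
cod-from-golay p r L k slots golay golays = positive , X , λ a b s t →
  trans (isCOD a b s t) (cong (λ w → if eqᶠ a b ∧ eqᶠ s t then fromℕᵍ w else 0ᵍ) (weight≡ s))
  where
  length≡ : ∀ K r → 2 * K + r + 1 ≡ suc K + (K + r)
  length≡ = ℕSolver.solve-∀
  m≡ = length≡ (sumℕ L k) r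
  open Layout r L (2 * sumℕ L k + r + 1) k {{>-nonZero (subst (0 <_) (sym m≡) z<s)}} m≡
    (golayPair golay) (λ j → complexGolayPair (golays j))
  open Slots {2 + L} slots
  open Design sequences slot slot-injective using (X; isCOD)
  positive : ∀ j → 0 < codWeights (suc p) r L k j
  positive zero          = ℕₚ.m^n>0 2 (suc p)
  positive (suc zero)    = ℕₚ.*-mono-≤ (ℕₚ.m^n>0 2 (suc p)) (proj₁ golay)
  positive (suc (suc j)) = ℕₚ.*-mono-≤ (ℕₚ.m^n>0 2 (suc p + 1)) (proj₁ (golays j))
  lem₀ : ∀ P → P * 2 ≡ 2 * P
  lem₀ = ℕSolver.solve-∀
  lem₁ : ∀ P r → P * (r + r) ≡ 2 * P * r
  lem₁ = ℕSolver.solve-∀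
  lem₂ : ∀ P k → P * ((k + k) + (k + k)) ≡ 2 * P * 2 * k
  lem₂ = ℕSolver.solve-∀
  -- The weights `2`, `2r` and `4k` are scaled by `2^p`, the squared length of a Sylvester row. With
  -- `q = p + 1` this yields the exponents `q`, `q` and `q + 1`.
  weight≡ : ∀ j → 2 ^ p * weight j ≡ codWeights (suc p) r L k j
  weight≡ zero          = lem₀ (2 ^ p)
  weight≡ (suc zero)    = lem₁ (2 ^ p) r
  weight≡ (suc (suc j)) = trans (lem₂ (2 ^ p) (k j)) (cong (_* k j) (sym (ℕₚ.^-distribˡ-+-* 2 (suc p) 1)))

-- Here `n` is the parameter of the theorem less 3. Two bits for each of the `2^n + 1` variables
-- make `2^(n+1) + 2`, against `2^(n+2) + n + 1` available; each surplus bit doubles the order and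
-- all weights alike.
slots-suffice : ∀ n → (2 + (2 ^ n ∸ 1)) * 2 ≤ 2 ^ (2 + n) + suc n
slots-suffice n with 2 ^ n | ℕₚ.m^n>0 2 n
... | suc P | _ = subst ((2 + P) * 2 ≤_) (lem P n) (ℕₚ.m≤m+n ((2 + P) * 2) (2 * P + suc n))
  where
  lem : ∀ P n → (2 + P) * 2 + (2 * P + suc n) ≡ 2 * (2 * suc P) + suc n
  lem = ℕSolver.solve-∀

theorem17 : (n : ℕ) → 2 < n → (r : ℕ) → GolayNumber r →
    (k : Fin (2 ^ (n ∸ 3) ∸ 1) → ℕ) → (∀ j → ComplexGolayNumber (k j)) →
    COD (2 ^ (2 ^ (n ∸ 1) + (n ∸ 1)) * (2 * sumℕ (2 ^ (n ∸ 3) ∸ 1) k + r + 1))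
    (codWeights (2 ^ (n ∸ 1) + (n ∸ 1)) r (2 ^ (n ∸ 3) ∸ 1) k)
theorem17 (suc (suc (suc n))) (s≤s (s≤s (s≤s z≤n))) r golay k golays =
  -- The exponent `q` is written as a successor: one bit is `κ`, the others form `ρ`.
  subst (λ q → COD (2 ^ q * (2 * sumℕ L k + r + 1)) (codWeights q r L k)) (sym (ℕₚ.+-suc (2 ^ (2 + n)) (suc n)))
    (cod-from-golay (2 ^ (2 + n) + suc n) r L k (slots-suffice n) golay golays)
  where
  L : ℕ
  L = 2 ^ n ∸ 1
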